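{- Let $n\ge 2$, $v\ge 2$ and $k\ge 1$, and let $W$ be a balanced generalized weighing matrix $BGW(v,k,\lambda;\mathbb{Z}_n)$. Let $A_{0,i}$, $A_1$, $A_{2,i}$, $A_3$ ($0\le i\le n-1$) be the $2nv\times 2nv$ $(0,1)$-matrices associated with $W$ as defined in the context. Then the following hold: 1. If $k=v$, then $\{A_{0,i},A_1,A_{2,i}\mid 0\le i\le n-1\}$ is a commutative association scheme. 2. If $k<v$, then $\{A_{0,i},A_1,A_{2,i},A_3\mid 0\le i\le n-1\}$ is a commutative association scheme. 3. The association schemes in 1 and 2 are symmetric if and only if $n=2$.
   Context: Balanced generalized weighing matrices. Let $\mathbb{Z}_n=\{\bar 0,\bar 1,\dots,\overline{n-1}\}$ be the additive cyclic group of order $n$. A $BGW(v,k,\lambda;\mathbb{Z}_n)$ is a $v\times v$ matrix $W=(w_{ij})$ with entries in $\mathbb{Z}_n\cup\{0\}$, where $0$ is a formal zero symbol different from the group element $\bar 0$, such that each row has exactly $k$ nonzero entries (entries in $\mathbb{Z}_n$) and, for any distinct rows $i,j$, the multiset $\{w_{i\ell}-w_{j\ell}\mid w_{i\ell},w_{j\ell}\in\mathbb{Z}_n\}$ contains every element of $\mathbb{Z}_n$ exactly $\lambda/n$ times. The matrices $B_i$. For $0\le i\le n-1$, $B_i$ is the $v\times v$ $(0,1)$-matrix with $(B_i)_{ab}=1$ if and only if $w_{ab}=\bar i$. Indices of $B$ are taken modulo $n$. The adjacency matrices. Let $P=\mathrm{circ}(0,1,0,\dots,0)$ be the $n\times n$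 circulant permutation matrix with first row $(0,1,0,\dots,0)$; $I_m$ and $J_m$ denote the identity and all-ones matrices of order $m$. Define, for $0\le i\le n-1$, $$A_{0,i}=\begin{bmatrix}P^i\otimes I_v&0\\0&P^i\otimes I_v\end{bmatrix},\qquad A_1=\begin{bmatrix}J_n\otimes(J_v-I_v)&0\\0&J_n\otimes(J_v-I_v)\end{bmatrix},$$ $$A_{2,i}=\begin{bmatrix}0&\sum_{j=0}^{n-1}P^j\otimes B_{i+j}\\ \sum_{j=0}^{n-1}P^j\otimes B_{ -i-j}^t&0\end{bmatrix},\qquad A_3=\begin{bmatrix}0&J_n\otimes\left(J_v-\sum_{j=0}^{n-1}B_j\right)\\ J_n\otimes\left(J_v-\sum_{j=0}^{n-1}B_j^t\right)&0\end{bmatrix}.$$ Association schemes. A commutative association scheme with $d$ classes on a finite set $X$ is a collection of nonzero $(0,1)$-matrices $A_0,A_1,\dots,A_d$ indexed by $X$ such that: $A_0=I_{|X|}$; $\sum_{i=0}^d A_i=J_{|X|}$; $A_i^t\in\{A_1,\dots,A_d\}$ for every $i\in\{1,\dots,d\}$; every product $A_iA_j$ is a linear combination of $A_0,\dots,A_d$; and $A_iA_j=A_jA_i$ for all $i,j$. It is symmetric if $A_i^t=A_i$ for all $i$. In the present case the identity matrix is $A_{0,0}$. -}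

module Defs where

import Algebra.Properties.Semiring.Sum
open import Data.Bool.Base using (if_then_else_)
open import Data.Bool.Properties using (T?)
open import Data.Fin.Base as Fin using (Fin; toℕ; splitAt; remQuot; _↑ˡ_)
import Data.Fin.Properties as Fin
open import Data.Integer.Base using (ℤ; 0ℤ; 1ℤ; _+_; _-_; _*_)
import Data.Integer.Properties as ℤ
open import Data.List.Base using (List; length; filter; mapMaybe; allFin)
open import Data.Maybe.Base using (Maybe; just; zipWith; is-just)
import Data.Maybe.Properties as Maybe
open import Data.Nat.Base as ℕ using (ℕ; zero; suc; NonZero)
open import Data.Nat.Divisibility using (_∣_)
open import Data.Nat.DivMod using (_/_; _mod_)
import Data.Nat.Properties as ℕ
open import Data.Product.Base using (_×_; _,_; ∃-syntax)
open import Data.Sum.Base using (_⊎_; inj₁; inj₂)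
open import Data.Vec.Functional using (Vector; _∷_; []; _++_)
open import Function.Base using (_∘_)
open import Relation.Binary.PropositionalEquality using (_≡_; _≢_)
open import Relation.Nullary using (¬_; Dec; does)

open Algebra.Properties.Semiring.Sum ℤ.+-*-semiring using (sum-syntax)

-- ℤ_n is carried by Fin n.
module _ {n : ℕ} .{{_ : NonZero n}} where

  infixl 6 _⊕_ _⊖_

  0̄ : Fin n
  0̄ = 0 mod n

  _⊕_ : Fin n → Fin n → Fin n
  i ⊕ j = (toℕ i ℕ.+ toℕ j) mod n

  ⊖_ : Fin n → Fin n
  ⊖ i = (n ℕ.∸ toℕ i) mod n

  _⊖_ : Fin n → Fin n → Fin n
  i ⊖ j = i ⊕ (⊖ j)

Matrix : ℕ → ℕ → Set
Matrix r c = Fin r → Fin c → ℤ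

private
  variable
    m n p q v r c r₁ r₂ c₁ c₂ : ℕ

indicator : {P : Set} → Dec P → ℤ
indicator P? = if does P? then 1ℤ else 0ℤ

infix  4 _≋_
infixl 6 _-ᴹ_
infixl 7 _*ᴹ_
infixl 7 _⊗_
infixr 8 _^ᴹ_
infix  9 _ᵀ

-- Entrywise, since function extensionality is not available.
_≋_ : Matrix r c → Matrix r c → Set
A ≋ B = ∀ a b → A a b ≡ B a b

𝟘 : Matrix r c
𝟘 _ _ = 0ℤ

I : ∀ m → Matrix m m
I m a b = indicator (a Fin.≟ b)

J : ∀ m → Matrix m m
J m _ _ = 1ℤ

_ᵀ : Matrix r c → Matrix c r
(A ᵀ) a b = A b a

_-ᴹ_ : Matrix r c → Matrix r c → Matrix r c
(A -ᴹ B) a b = A a b - B a b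

∑ᴹ : Vector (Matrix r c) n → Matrix r c
∑ᴹ {n = n} A a b = ∑[ i < n ] A i a b

linearCombination : Vector ℤ n → Vector (Matrix r c) n → Matrix r c
linearCombination {n = n} coeff A a b = ∑[ i < n ] (coeff i * A i a b)

_*ᴹ_ : Matrix p q → Matrix q r → Matrix p r
_*ᴹ_ {q = q} A B a b = ∑[ l < q ] (A a l * B l b)

_^ᴹ_ : Matrix m m → ℕ → Matrix m m
A ^ᴹ zero  = I _
A ^ᴹ suc e = A *ᴹ (A ^ᴹ e)

_⊗_ : Matrix r₁ c₁ → Matrix r₂ c₂ → Matrix (r₁ ℕ.* r₂) (c₁ ℕ.* c₂)
_⊗_ {r₂ = r₂} {c₂ = c₂} A B x y with remQuot r₂ x | remQuot c₂ y
... | a₁ , a₂ | b₁ , b₂ = A a₁ b₁ * B a₂ b₂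

block : Matrix r₁ c₁ → Matrix r₁ c₂ →
        Matrix r₂ c₁ → Matrix r₂ c₂ →
        Matrix (r₁ ℕ.+ r₂) (c₁ ℕ.+ c₂)
block {r₁ = r₁} {c₁ = c₁} A B C D x y with splitAt r₁ x | splitAt c₁ y
... | inj₁ a | inj₁ b = A a b
... | inj₁ a | inj₂ b = B a b
... | inj₂ a | inj₁ b = C a b
... | inj₂ a | inj₂ b = D a b

circ : .{{_ : NonZero n}} → Vector ℤ n → Matrix n n
circ row a b = row (b ⊖ a)

-- The family is indexed by Fin m, where m = d + 1 for a scheme with d
-- classes, and i₀ is the index of the identity matrix.  The matrices have
-- entries 0 and 1 and sum to J, so the coefficients of a product of two of
-- them are entries of that product; hence integer coefficients are no
-- restriction compared with rational, real or complex ones.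
record IsCommutativeAssociationScheme
         {N m : ℕ} (i₀ : Fin m) (A : Vector (Matrix N N) m) : Set where
  field
    zero-one    : ∀ i a b → A i a b ≡ 0ℤ ⊎ A i a b ≡ 1ℤ
    nonzero     : ∀ i → ¬ (A i ≋ 𝟘)
    identity    : A i₀ ≋ I N
    sums-to-J   : ∑ᴹ A ≋ J N
    transpose   : ∀ i → i ≢ i₀ → ∃[ j ] (j ≢ i₀ × A i ᵀ ≋ A j)
    product     : ∀ i j → ∃[ coeff ] A i *ᴹ A j ≋ linearCombination coeff A
    commutative : ∀ i j → A i *ᴹ A j ≋ A j *ᴹ A i

IsSymmetric : {N m : ℕ} → Vector (Matrix N N) m → Set
IsSymmetric A = ∀ i → A i ᵀ ≋ A i

-- The formal zero symbol is nothing; the group element ī is just i.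
EntryMatrix : ℕ → ℕ → Set
EntryMatrix n v = Fin v → Fin v → Maybe (Fin n)

weight : EntryMatrix n v → Fin v → ℕ
weight {v = v} W i = length (filter (λ l → T? (is-just (W i l))) (allFin v))

-- zipWith yields nothing unless both entries are group elements, so this
-- lists exactly the differences at common nonzero positions.
differences : .{{_ : NonZero n}} → EntryMatrix n v → Fin v → Fin v → List (Fin n)
differences {v = v} W i j =
  mapMaybe (λ l → zipWith _⊖_ (W i l) (W j l)) (allFin v)

multiplicity : Fin n → List (Fin n) → ℕ
multiplicity g = length ∘ filter (g Fin.≟_)

record IsBGW (n v k lam : ℕ) .{{_ : NonZero n}} (W : EntryMatrix n v) : Set where
  field
    row-weight : ∀ i → weight W i ≡ k
    n∣lam      : n ∣ lam
    balanced   : ∀ i j → i ≢ j → ∀ g → multiplicity g (differences W i j) ≡ lam / n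

P : ∀ n → .{{_ : NonZero n}} → Matrix n n
P n = circ (λ a → indicator (toℕ a ℕ.≟ 1))

module _ {n v : ℕ} .{{_ : NonZero n}} (W : EntryMatrix n v) where

  B : Fin n → Matrix v v
  B i a b = indicator (Maybe.≡-dec Fin._≟_ (W a b) (just i))

  size : ℕ
  size = n ℕ.* v ℕ.+ n ℕ.* v

  A₀ : Fin n → Matrix size size
  A₀ i = block ((P n ^ᴹ toℕ i) ⊗ I v) 𝟘
               𝟘                      ((P n ^ᴹ toℕ i) ⊗ I v)

  A₁ : Matrix size size
  A₁ = block (J n ⊗ (J v -ᴹ I v)) 𝟘
             𝟘                    (J n ⊗ (J v -ᴹ I v))

  A₂ : Fin n → Matrix size size
  A₂ i = block 𝟘 (∑ᴹ λ j → (P n ^ᴹ toℕ j) ⊗ B (i ⊕ j))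
               (∑ᴹ λ j → (P n ^ᴹ toℕ j) ⊗ B ((⊖ i) ⊖ j) ᵀ) 𝟘

  A₃ : Matrix size size
  A₃ = block 𝟘 (J n ⊗ (J v -ᴹ ∑ᴹ B))
               (J n ⊗ (J v -ᴹ ∑ᴹ λ j → B j ᵀ)) 𝟘

  withoutA₃ : Vector (Matrix size size) (n ℕ.+ (1 ℕ.+ n))
  withoutA₃ = A₀ ++ (A₁ ∷ A₂)

  withA₃ : Vector (Matrix size size) (n ℕ.+ (1 ℕ.+ (n ℕ.+ 1)))
  withA₃ = A₀ ++ (A₁ ∷ (A₂ ++ (A₃ ∷ [])))

-- The index of A₀ 0̄ in either family.
identityIndex : .{{_ : NonZero n}} → Fin (n ℕ.+ m)
identityIndex {m = m} = 0̄ ↑ˡ m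

{-# OPTIONS --safe #-}

-- Colour a pair of points of (ℤ_n × v) ⊎ (ℤ_n × v) by the one matrix of the
-- family having a 1 there.  Translation by ℤ_n maps colours to colours and
-- realises the A₀ i; modulo these, A₁ and A₃ are differences of a block
-- all-ones matrix and ∑ A₀ i or ∑ A₂ i, and A₂ i A₂ j is a translate of
-- (A₂ 0̄)².  The diagonal blocks of (A₂ 0̄)² are M Mᵀ and Mᵀ M, where M is the
-- nv × nv matrix ∑ Pʲ ⊗ B j.  M Mᵀ is the balance condition on the rows of W,
-- so what is left is the dual statement Mᵀ M = M Mᵀ.  It follows from
-- tr((Mᵀ M)²) = tr((M Mᵀ)²) and its variant twisted by a translation: the
-- twisted variant forces all column sums to be k, and then the sum of the
-- squares of the entries of Mᵀ M − M Mᵀ vanishes.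

module Submission where

open import Defs
open import Data.Nat using (ℕ; _≤_; _<_; NonZero)
open import Data.Product using (_×_)
open import Function.Bundles using (_⇔_)
open import Relation.Binary.PropositionalEquality using (_≡_)

open import Algebra.Bundles using (AbelianGroup)
import Algebra.Properties.AbelianGroup as AbelianGroupProperties
import Algebra.Properties.Semiring.Sum
open import Data.Bool.Base using (Bool; true; false; if_then_else_; _xor_)
open import Data.Bool.Properties using (T?)
import Data.Bool.Properties as Bool
open import Data.Fin.Base as Fin using (Fin; zero; suc; toℕ; splitAt; remQuot; combine; _↑ˡ_; _↑ʳ_)
import Data.Fin.Permutation as Perm
import Data.Fin.Properties as Fin
import Data.Integer.Base as ℤᵇ
open import Data.Integer.Base using (ℤ; 0ℤ; 1ℤ; -[1+_]; _+_; _-_; _*_; +≤+) renaming (_≤_ to _≤ℤ_)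
import Data.Integer.Properties as ℤ
open import Data.Integer.Tactic.RingSolver using (solve-∀)
open import Data.List.Base using (length; filter; mapMaybe; tabulate)
open import Data.Maybe.Base using (Maybe; just; nothing; maybe′; zipWith; is-just)
import Data.Maybe.Properties as Maybe
import Data.Nat.Base as ℕ
open import Data.Nat.Base using (zero; suc)
open import Data.Nat.DivMod using (_%_; _/_; _mod_; %-distribˡ-+; n%n≡0; m<n⇒m%n≡m; m%n<n)
import Data.Nat.Properties as ℕ
open import Data.Product using (_,_; ∃-syntax; proj₁; proj₂; uncurry)
open import Data.Sum.Base as Sum using (_⊎_; inj₁; inj₂)
open import Data.Vec.Functional using (Vector; _∷_; []; _++_)
open import Data.Vec.Functional.Properties using (lookup-++ˡ; lookup-++ʳ)
open import Function.Base using (_∘_)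
open import Function.Bundles using (mk⇔)
open import Relation.Binary.Definitions using (DecidableEquality)
open import Relation.Binary.PropositionalEquality
  using (_≢_; refl; sym; trans; cong; cong₂; subst; subst₂; isEquivalence; module ≡-Reasoning)
open import Relation.Nullary using (¬_; Dec; yes; no; _because_; contradiction)
open import Relation.Nullary.Decidable using (map′; ¬?; does-⇔; dec-true; dec-false; decidable-stable)

open Algebra.Properties.Semiring.Sum ℤ.+-*-semiring
  using ( sum; sum-syntax; sum-cong-≗; sum-replicate-zero; sum-permute
        ; ∑-comm; ∑-distrib-+; *-distribˡ-sum; *-distribʳ-sum )

-- Balance is assumed for rows only. The usual passage to columns, cancelling `M` in M Mᵀ M, is
-- blocked: on vectors that are constant on the classes ℤ_n × a and have total 0, the matrix M Mᵀ
-- acts as k - λ, and k = v forces λ = v, so `M` is singular in that case. Trace identities need no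
-- inverse. The untwisted identity alone involves the unknown inner products of columns from
-- different classes. Subtracting the twisted one leaves only the diagonal on the row side, k² for
-- each point. On the column side it is half the sum of the squares of X - XT, where X = Mᵀ M and XT
-- is X with its columns translated, and the diagonal of X alone bounds this sum from below. The
-- diagonal entries have mean k, so the bound forces each of them to be k. The translation has to
-- move every point, which needs n ≥ 2.

private
  variable
    m n v p q r : ℕ
    S : Set
    Φ Ψ : Set

-- Indicators and finite sums of integers

indicator-true : (P? : Dec Φ) → Φ → indicator P? ≡ 1ℤ
indicator-true P? p = cong (if_then 1ℤ else 0ℤ) (dec-true P? p)

indicator-false : (P? : Dec Φ) → ¬ Φ → indicator P? ≡ 0ℤ
indicator-false P? ¬p = cong (if_then 1ℤ else 0ℤ) (dec-false P? ¬p)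

indicator-⇔ : (Φ → Ψ) → (Ψ → Φ) → (P? : Dec Φ) (Q? : Dec Ψ) → indicator P? ≡ indicator Q?
indicator-⇔ Φ→Ψ Ψ→Φ P? Q? = cong (if_then 1ℤ else 0ℤ) (does-⇔ (mk⇔ Φ→Ψ Ψ→Φ) P? Q?)

indicator-idem : (P? : Dec Φ) → indicator P? * indicator P? ≡ indicator P?
indicator-idem (true because _)  = refl
indicator-idem (false because _) = refl

indicator-zero-one : (P? : Dec Φ) → indicator P? ≡ 0ℤ ⊎ indicator P? ≡ 1ℤ
indicator-zero-one (true because _)  = inj₂ refl
indicator-zero-one (false because _) = inj₁ refl

indicator≡1⇒ : (P? : Dec Φ) → indicator P? ≡ 1ℤ → Φ
indicator≡1⇒ (yes p) _ = p

indicator-*-cong : (P? : Dec Φ) {x y : ℤ} → (Φ → x ≡ y) → indicator P? * x ≡ indicator P? * y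
indicator-*-cong (yes p) x≡y = cong (1ℤ *_) (x≡y p)
indicator-*-cong (no _)  _   = refl

∑-cong : ∀ n {f g : Vector ℤ n} → (∀ i → f i ≡ g i) → sum f ≡ sum g
∑-cong n = sum-cong-≗ {n}

∑-zero : (f : Vector ℤ n) → (∀ i → f i ≡ 0ℤ) → sum f ≡ 0ℤ
∑-zero {n} f f≡0 = trans (∑-cong n f≡0) (sum-replicate-zero n)

∑-only : (c : Fin n) (f : Vector ℤ n) → (∀ i → i ≢ c → f i ≡ 0ℤ) → sum f ≡ f c
∑-only zero f f≡0 =
  trans (cong (f zero +_) (∑-zero (f ∘ suc) λ i → f≡0 (suc i) λ ())) (ℤ.+-identityʳ _)
∑-only (suc c) f f≡0 =
  trans (cong₂ _+_ (f≡0 zero λ ()) (∑-only c (f ∘ suc) λ i i≢c → f≡0 (suc i) (i≢c ∘ Fin.suc-injective)))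
        (ℤ.+-identityˡ _)

-- Nearly every sum below runs against a row with a single 1, and this evaluates it at the support
-- point `c`.
∑-unique : {R : Fin n → Set} (R? : ∀ i → Dec (R i)) (c : Fin n) → R c → (∀ i → R i → i ≡ c) →
           (f : Vector ℤ n) → ∑[ i < n ] (indicator (R? i) * f i) ≡ f c
∑-unique R? c Rc unique f = trans
  (∑-only c _ λ i i≢c → cong (_* f i) (indicator-false (R? i) (i≢c ∘ unique i)))
  (trans (cong (_* f c) (indicator-true (R? c) Rc)) (ℤ.*-identityˡ _))

∑-unique-1 : {R : Fin n → Set} (R? : ∀ i → Dec (R i)) (c : Fin n) → R c → (∀ i → R i → i ≡ c) →
             ∑[ i < n ] indicator (R? i) ≡ 1ℤ
∑-unique-1 {n} R? c Rc unique = trans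
  (∑-cong n λ i → sym (ℤ.*-identityʳ _)) (∑-unique R? c Rc unique (λ _ → 1ℤ))

∑-distrib-minus : (f g : Vector ℤ n) → ∑[ i < n ] (f i - g i) ≡ sum f - sum g
∑-distrib-minus {zero}  f g = refl
∑-distrib-minus {suc n} f g = trans
  (cong (_+_ (f zero - g zero)) (∑-distrib-minus (f ∘ suc) (g ∘ suc)))
  (lemma (f zero) (g zero) (sum (f ∘ suc)) (sum (g ∘ suc)))
  where
  lemma : ∀ a b c d → a - b + (c - d) ≡ a + c - (b + d)
  lemma = solve-∀

∑-reindex : (f : Vector ℤ n) (to from : Fin n → Fin n) →
            (∀ i → to (from i) ≡ i) → (∀ i → from (to i) ≡ i) →
            ∑[ i < n ] f (to i) ≡ sum f
∑-reindex f to from to∘from from∘to = sym (sum-permute f (Perm.permutation to from to∘from from∘to))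

∑-↑ : ∀ m {n} (f : Vector ℤ (m ℕ.+ n)) → sum f ≡ ∑[ i < m ] f (i ↑ˡ n) + ∑[ j < n ] f (m ↑ʳ j)
∑-↑ zero    f = sym (ℤ.+-identityˡ _)
∑-↑ (suc m) f = trans (cong (f zero +_) (∑-↑ m (f ∘ suc))) (sym (ℤ.+-assoc (f zero) _ _))

∑-combine : ∀ m {n} (f : Vector ℤ (m ℕ.* n)) → sum f ≡ ∑[ i < m ] ∑[ j < n ] f (combine i j)
∑-combine zero        f = refl
∑-combine (suc m) {n} f =
  trans (∑-↑ n f) (cong (_+_ (∑[ j < n ] f (j ↑ˡ (m ℕ.* n)))) (∑-combine m (f ∘ (n ↑ʳ_))))

∑-mono : (f g : Vector ℤ n) → (∀ i → f i ≤ℤ g i) → sum f ≤ℤ sum g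
∑-mono {zero}  f g f≤g = ℤ.≤-refl
∑-mono {suc n} f g f≤g = ℤ.+-mono-≤ (f≤g zero) (∑-mono (f ∘ suc) (g ∘ suc) (f≤g ∘ suc))

∑-nonneg : (f : Vector ℤ n) → (∀ i → 0ℤ ≤ℤ f i) → 0ℤ ≤ℤ sum f
∑-nonneg {n} f 0≤f = subst (_≤ℤ sum f) (sum-replicate-zero n) (∑-mono (λ _ → 0ℤ) f 0≤f)

∑≤0⇒≡0 : (f : Vector ℤ n) → (∀ i → 0ℤ ≤ℤ f i) → sum f ≤ℤ 0ℤ → ∀ i → f i ≡ 0ℤ
∑≤0⇒≡0 {suc n} f 0≤f ∑≤0 zero = ℤ.≤-antisym
  (ℤ.≤-trans (subst (_≤ℤ sum f) (ℤ.+-identityʳ _) (ℤ.+-monoʳ-≤ (f zero) (∑-nonneg (f ∘ suc) (0≤f ∘ suc)))) ∑≤0)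
  (0≤f zero)
∑≤0⇒≡0 {suc n} f 0≤f ∑≤0 (suc i) = ∑≤0⇒≡0 (f ∘ suc) (0≤f ∘ suc)
  (ℤ.≤-trans (subst (_≤ℤ sum f) (ℤ.+-identityˡ _) (ℤ.+-monoˡ-≤ (sum (f ∘ suc)) (0≤f zero))) ∑≤0) i

square-nonneg : ∀ x → 0ℤ ≤ℤ x * x
square-nonneg (ℤᵇ.+ x)   = subst (0ℤ ≤ℤ_) (ℤ.pos-* x x) (+≤+ ℕ.z≤n)
square-nonneg -[1+ x ] = +≤+ ℕ.z≤n

square≡0⇒≡0 : ∀ x → x * x ≡ 0ℤ → x ≡ 0ℤ
square≡0⇒≡0 x eq with ℤ.i*j≡0⇒i≡0∨j≡0 x eq
... | inj₁ x≡0 = x≡0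
... | inj₂ x≡0 = x≡0

∑-squares≤0⇒≡0 : (f : Vector ℤ n) → ∑[ i < n ] (f i * f i) ≤ℤ 0ℤ → ∀ i → f i ≡ 0ℤ
∑-squares≤0⇒≡0 f ∑≤0 i = square≡0⇒≡0 (f i) (∑≤0⇒≡0 _ (λ i → square-nonneg (f i)) ∑≤0 i)

-- Duality of Gram matrices

∑-*-∑ : ∀ m n (f : Vector ℤ m) (g : Vector ℤ n) → sum f * sum g ≡ ∑[ i < m ] ∑[ j < n ] (f i * g j)
∑-*-∑ m n f g = trans (*-distribʳ-sum (sum g) f) (∑-cong m λ i → *-distribˡ-sum (f i) g)

∑₂ : Matrix n n → ℤ
∑₂ {n} A = ∑[ x < n ] ∑[ y < n ] A x y

∑₂-cong : ∀ n {A B : Matrix n n} → A ≋ B → ∑₂ A ≡ ∑₂ B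
∑₂-cong n A≋B = ∑-cong n λ x → ∑-cong n (A≋B x)

∑₂-distrib-minus : (A B : Matrix n n) → ∑₂ (A -ᴹ B) ≡ ∑₂ A - ∑₂ B
∑₂-distrib-minus {n} A B = trans (∑-cong n λ x → ∑-distrib-minus (A x) (B x))
                             (∑-distrib-minus (λ x → sum (A x)) (λ x → sum (B x)))

∑₂-distrib-* : (c : ℤ) (A : Matrix n n) → ∑₂ (λ x y → c * A x y) ≡ c * ∑₂ A
∑₂-distrib-* {n} c A = sym (trans (*-distribˡ-sum c (λ x → sum (A x))) (∑-cong n λ x → *-distribˡ-sum c (A x)))

_∘ᴹ_ : Matrix n n → Matrix n n → Matrix n n
(A ∘ᴹ B) x y = A x y * B x y

-- Both sides sum `A u y * B u z * C w y * D w z` over all u, w, y, z; the left groups factors by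
-- common row, the right by common column. Four equal arguments give the trace identity, a
-- translated `D` its twisted variant.
∑₂-gram-exchange : (A B C D : Matrix n n) →
                   ∑₂ ((A ᵀ *ᴹ B) ∘ᴹ (C ᵀ *ᴹ D)) ≡ ∑₂ ((A *ᴹ C ᵀ) ∘ᴹ (B *ᴹ D ᵀ))
∑₂-gram-exchange {n} A B C D = begin
  ∑[ y < n ] ∑[ z < n ] ((A ᵀ *ᴹ B) y z * (C ᵀ *ᴹ D) y z)
    ≡⟨ (∑-cong n λ y → ∑-cong n λ z → ∑-*-∑ n n (λ u → A u y * B u z) (λ w → C w y * D w z)) ⟩
  ∑[ y < n ] ∑[ z < n ] ∑[ u < n ] ∑[ w < n ] ((A u y * B u z) * (C w y * D w z))
    ≡⟨ (∑-cong n λ y → ∑-comm λ z u → ∑[ w < n ] ((A u y * B u z) * (C w y * D w z))) ⟩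
  ∑[ y < n ] ∑[ u < n ] ∑[ z < n ] ∑[ w < n ] ((A u y * B u z) * (C w y * D w z))
    ≡⟨ ∑-comm (λ y u → ∑[ z < n ] ∑[ w < n ] ((A u y * B u z) * (C w y * D w z))) ⟩
  ∑[ u < n ] ∑[ y < n ] ∑[ z < n ] ∑[ w < n ] ((A u y * B u z) * (C w y * D w z))
    ≡⟨ (∑-cong n λ u → ∑-cong n λ y → ∑-comm λ z w → (A u y * B u z) * (C w y * D w z)) ⟩
  ∑[ u < n ] ∑[ y < n ] ∑[ w < n ] ∑[ z < n ] ((A u y * B u z) * (C w y * D w z))
    ≡⟨ (∑-cong n λ u → ∑-comm λ y w → ∑[ z < n ] ((A u y * B u z) * (C w y * D w z))) ⟩
  ∑[ u < n ] ∑[ w < n ] ∑[ y < n ] ∑[ z < n ] ((A u y * B u z) * (C w y * D w z))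
    ≡⟨ (∑-cong n λ u → ∑-cong n λ w → ∑-cong n λ y → ∑-cong n λ z → middle-four (A u y) (B u z) (C w y) (D w z)) ⟩
  ∑[ u < n ] ∑[ w < n ] ∑[ y < n ] ∑[ z < n ] ((A u y * C w y) * (B u z * D w z))
    ≡⟨ (∑-cong n λ u → ∑-cong n λ w → ∑-*-∑ n n (λ y → A u y * C w y) (λ z → B u z * D w z)) ⟨
  ∑[ u < n ] ∑[ w < n ] ((A *ᴹ C ᵀ) u w * (B *ᴹ D ᵀ) u w) ∎
  where
  open ≡-Reasoning
  middle-four : ∀ a b c d → (a * b) * (c * d) ≡ (a * c) * (b * d)
  middle-four = solve-∀

-- A statement about divisible designs: `cls` partitions the indices of rows and of columns alike,
-- and `T` is a fixed-point-free automorphism that preserves every class. The inner products assumed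
-- are those of rows, except that `M-orthogonal` makes columns of one class disjoint.
module Duality
  {N : ℕ} {C : Set} (cls : Fin N → C) (_≟_ : DecidableEquality C)
  (M : Matrix N N) (k μ : ℤ) (T T⁻¹ : Fin N → Fin N)
  (T∘T⁻¹ : ∀ x → T (T⁻¹ x) ≡ x) (T⁻¹∘T : ∀ x → T⁻¹ (T x) ≡ x)
  (cls-T : ∀ x → cls (T x) ≡ cls x) (T-free : ∀ x → T x ≢ x)
  (M-T : ∀ x y → M (T x) (T y) ≡ M x y)
  (M-idem : ∀ x y → M x y * M x y ≡ M x y)
  (M-orthogonal : ∀ x {y z} → y ≢ z → cls y ≡ cls z → M x y * M x z ≡ 0ℤ)
  (gram-diagonal : ∀ x → (M *ᴹ M ᵀ) x x ≡ k)
  (gram-class : ∀ {x y} → x ≢ y → cls x ≡ cls y → (M *ᴹ M ᵀ) x y ≡ 0ℤ)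
  (gram-other : ∀ {x y} → cls x ≢ cls y → (M *ᴹ M ᵀ) x y ≡ μ)
  where

  open ≡-Reasoning

  K X MT XT KT : Matrix N N
  K = M *ᴹ M ᵀ
  X = M ᵀ *ᴹ M
  MT x y = M x (T y)
  XT x y = X x (T y)
  KT x y = K (T x) y

  X-class : ∀ {y z} → y ≢ z → cls y ≡ cls z → X y z ≡ 0ℤ
  X-class y≢z eq = ∑-zero _ λ x → M-orthogonal x y≢z eq

  ⟨X,X⟩ : ∑₂ (X ∘ᴹ X) ≡ ∑₂ (K ∘ᴹ K)
  ⟨X,X⟩ = ∑₂-gram-exchange M M M M

  -- Invariance of `M` under `T` moves the twist from columns to rows, where the inner products are
  -- known.
  M*MTᵀ : M *ᴹ MT ᵀ ≋ KT
  M*MTᵀ x y = begin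
    ∑[ z < N ] (M x z * M y (T z))         ≡⟨ ∑-cong N (λ z → cong (_* M y (T z)) (sym (M-T x z))) ⟩
    ∑[ z < N ] (M (T x) (T z) * M y (T z)) ≡⟨ ∑-reindex (λ z → M (T x) z * M y z) T T⁻¹ T∘T⁻¹ T⁻¹∘T ⟩
    ∑[ z < N ] (M (T x) z * M y z)         ∎

  ⟨X,XT⟩ : ∑₂ (X ∘ᴹ XT) ≡ ∑₂ (K ∘ᴹ KT)
  ⟨X,XT⟩ = trans (∑₂-gram-exchange M M M MT) (∑₂-cong N λ x y → cong (K x y *_) (M*MTᵀ x y))

  -- Between different classes both factors are `μ`, since `T` stays within classes. Within a class
  -- `K x y` vanishes off the diagonal, and on the diagonal `K (T x) x` is 0 because `T` moves `x`.
  K∘K-K∘KT : ∀ x y → K x y * K x y - K x y * KT x y ≡ indicator (y Fin.≟ x) * (k * k)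
  K∘K-K∘KT x y with y Fin.≟ x
  ... | yes refl = trans (cong₂ (λ s t → s * s - s * t) (gram-diagonal x)
                                (gram-class (T-free x) (cls-T x)))
                         (lemma k)
    where
    lemma : ∀ k → k * k - k * 0ℤ ≡ 1ℤ * (k * k)
    lemma = solve-∀
  ... | no y≢x with cls x ≟ cls y
  ...   | yes eq = cong (λ s → s * s - s * KT x y) (gram-class (y≢x ∘ sym) eq)
  ...   | no neq = trans (cong₂ (λ s t → s * s - s * t) (gram-other neq)
                                (gram-other (neq ∘ trans (sym (cls-T x)))))
                         (ℤ.+-inverseʳ (μ * μ))

  ⟨K,K⟩-⟨K,KT⟩ : ∑₂ (K ∘ᴹ K) - ∑₂ (K ∘ᴹ KT) ≡ ∑[ x < N ] (k * k)
  ⟨K,K⟩-⟨K,KT⟩ = begin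
    ∑₂ (K ∘ᴹ K) - ∑₂ (K ∘ᴹ KT)         ≡⟨ ∑₂-distrib-minus (K ∘ᴹ K) (K ∘ᴹ KT) ⟨
    ∑₂ ((K ∘ᴹ K) -ᴹ (K ∘ᴹ KT))         ≡⟨ ∑₂-cong N K∘K-K∘KT ⟩
    ∑[ x < N ] ∑[ y < N ] (indicator (y Fin.≟ x) * (k * k))
      ≡⟨ ∑-cong N (λ x → ∑-unique (Fin._≟ x) x refl (λ _ eq → eq) (λ _ → k * k)) ⟩
    ∑[ x < N ] (k * k)                 ∎

  Δ² : Matrix N N
  Δ² y z = (X y z - XT y z) * (X y z - XT y z)

  ∑₂Δ² : ∑₂ Δ² ≡ ∑[ x < N ] (k * k) + ∑[ x < N ] (k * k)
  ∑₂Δ² = begin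
    ∑₂ Δ²                             ≡⟨ (∑₂-cong N λ y z → expand (X y z) (XT y z)) ⟩
    ∑₂ (((X ∘ᴹ X) -ᴹ (X ∘ᴹ XT)) -ᴹ ((X ∘ᴹ XT) -ᴹ (XT ∘ᴹ XT)))
      ≡⟨ ∑₂-distrib-minus ((X ∘ᴹ X) -ᴹ (X ∘ᴹ XT)) ((X ∘ᴹ XT) -ᴹ (XT ∘ᴹ XT)) ⟩
    ∑₂ ((X ∘ᴹ X) -ᴹ (X ∘ᴹ XT)) - ∑₂ ((X ∘ᴹ XT) -ᴹ (XT ∘ᴹ XT))
      ≡⟨ cong₂ _-_ (∑₂-distrib-minus (X ∘ᴹ X) (X ∘ᴹ XT)) (∑₂-distrib-minus (X ∘ᴹ XT) (XT ∘ᴹ XT)) ⟩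
    ∑₂ (X ∘ᴹ X) - ∑₂ (X ∘ᴹ XT) - (∑₂ (X ∘ᴹ XT) - ∑₂ (XT ∘ᴹ XT))
      -- The sum of the squares of `XT` is that of `X` with the columns permuted by `T`.
      ≡⟨ cong (λ t → ∑₂ (X ∘ᴹ X) - ∑₂ (X ∘ᴹ XT) - (∑₂ (X ∘ᴹ XT) - t))
              (∑-cong N λ y → ∑-reindex (λ z → X y z * X y z) T T⁻¹ T∘T⁻¹ T⁻¹∘T) ⟩
    ∑₂ (X ∘ᴹ X) - ∑₂ (X ∘ᴹ XT) - (∑₂ (X ∘ᴹ XT) - ∑₂ (X ∘ᴹ X))
      ≡⟨ cong₂ (λ s t → s - t - (t - s)) ⟨X,X⟩ ⟨X,XT⟩ ⟩
    ∑₂ (K ∘ᴹ K) - ∑₂ (K ∘ᴹ KT) - (∑₂ (K ∘ᴹ KT) - ∑₂ (K ∘ᴹ K))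
      ≡⟨ collect (∑₂ (K ∘ᴹ K)) (∑₂ (K ∘ᴹ KT)) ⟩
    (∑₂ (K ∘ᴹ K) - ∑₂ (K ∘ᴹ KT)) + (∑₂ (K ∘ᴹ K) - ∑₂ (K ∘ᴹ KT))
      ≡⟨ cong₂ _+_ ⟨K,K⟩-⟨K,KT⟩ ⟨K,K⟩-⟨K,KT⟩ ⟩
    ∑[ x < N ] (k * k) + ∑[ x < N ] (k * k) ∎
    where
    expand : ∀ a b → (a - b) * (a - b) ≡ a * a - a * b - (a * b - b * b)
    expand = solve-∀
    collect : ∀ s t → s - t - (t - s) ≡ (s - t) + (s - t)
    collect = solve-∀

  c : Fin N → ℤ
  c y = X y y

  at-y at-T⁻¹y : Fin N → Fin N → ℤ
  at-y   y z = indicator (z Fin.≟ y) * (c y * c y)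
  at-T⁻¹y y z = indicator (z Fin.≟ T⁻¹ y) * (c y * c y)

  -- In row y the difference X - XT is c y at the column y and - c y at the column T⁻¹ y,
  -- because X vanishes off the diagonal within a class.
  Δ²-lower : ∀ y z → at-y y z + at-T⁻¹y y z ≤ℤ Δ² y z
  Δ²-lower y z with z Fin.≟ y | z Fin.≟ T⁻¹ y
  -- These entries may be unknown inner products; it is enough that a square is nonnegative.
  ... | no _     | no _    = square-nonneg (X y z - XT y z)
  ... | yes refl | yes eq  = contradiction (trans (cong T eq) (T∘T⁻¹ y)) (T-free z)
  ... | yes refl | no _    = ℤ.≤-reflexive (trans (lemma (c y))
      (cong (λ t → (c y - t) * (c y - t)) (sym (X-class (T-free y ∘ sym) (sym (cls-T y))))))
    where
    lemma : ∀ t → 1ℤ * (t * t) + 0ℤ * (t * t) ≡ (t - 0ℤ) * (t - 0ℤ)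
    lemma = solve-∀
  ... | no z≢y   | yes refl = ℤ.≤-reflexive (trans (lemma (c y))
      (cong₂ (λ s t → (s - t) * (s - t)) (sym (X-class (z≢y ∘ sym) (sym cls-T⁻¹))) (cong (X y) (sym (T∘T⁻¹ y)))))
    where
    cls-T⁻¹ : cls (T⁻¹ y) ≡ cls y
    cls-T⁻¹ = trans (sym (cls-T (T⁻¹ y))) (cong cls (T∘T⁻¹ y))
    lemma : ∀ t → 0ℤ * (t * t) + 1ℤ * (t * t) ≡ (0ℤ - t) * (0ℤ - t)
    lemma = solve-∀

  ∑Δ²-lower : ∑[ y < N ] (c y * c y) + ∑[ y < N ] (c y * c y) ≤ℤ ∑₂ Δ²
  ∑Δ²-lower = subst (_≤ℤ ∑₂ Δ²)
    (trans (∑-cong N λ y → trans (∑-distrib-+ (at-y y) (at-T⁻¹y y))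
             (cong₂ _+_ (∑-unique (Fin._≟ y) y refl (λ _ eq → eq) (λ _ → c y * c y))
                        (∑-unique (Fin._≟ T⁻¹ y) (T⁻¹ y) refl (λ _ eq → eq) (λ _ → c y * c y))))
           (∑-distrib-+ (λ y → c y * c y) (λ y → c y * c y)))
    (∑-mono (λ y → ∑[ z < N ] (at-y y z + at-T⁻¹y y z)) (λ y → sum (Δ² y))
            λ y → ∑-mono (λ z → at-y y z + at-T⁻¹y y z) (Δ² y) (Δ²-lower y))

  ∑c²≤ : ∑[ y < N ] (c y * c y) ≤ℤ ∑[ y < N ] (k * k)
  ∑c²≤ = ℤ.≮⇒≥ λ lt → ℤ.<-irrefl refl
    (ℤ.<-≤-trans (ℤ.+-mono-< lt lt) (subst (∑[ y < N ] (c y * c y) + ∑[ y < N ] (c y * c y) ≤ℤ_) ∑₂Δ² ∑Δ²-lower))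

  -- Two counts of the ones of `M`, by columns and by rows.
  ∑c≡ : ∑[ y < N ] c y ≡ ∑[ y < N ] k
  ∑c≡ = trans (∑-comm λ y x → M x y * M x y) (∑-cong N gram-diagonal)

  -- A variance argument: the `c y` have mean `k` and mean square at most k², so the squares of c y
  -- - k have sum at most 0.
  c≡k : ∀ y → c y ≡ k
  c≡k y = ℤ.i-j≡0⇒i≡j _ _ (∑-squares≤0⇒≡0 (λ y → c y - k) (subst (_≤ℤ 0ℤ) (sym ∑≡) (ℤ.i≤j⇒i-j≤0 ∑c²≤)) y)
    where
    expand : ∀ c k → (c - k) * (c - k) ≡ c * c - k * k - (k + k) * (c - k)
    expand = solve-∀
    ∑[c-k]≡0 : ∑[ y < N ] (c y - k) ≡ 0ℤ
    ∑[c-k]≡0 = trans (∑-distrib-minus c (λ _ → k)) (ℤ.i≡j⇒i-j≡0 ∑c≡)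
    ∑≡ : ∑[ y < N ] ((c y - k) * (c y - k)) ≡ ∑[ y < N ] (c y * c y) - ∑[ y < N ] (k * k)
    ∑≡ = begin
      ∑[ y < N ] ((c y - k) * (c y - k))
        ≡⟨ ∑-cong N (λ y → expand (c y) k) ⟩
      ∑[ y < N ] (c y * c y - k * k - (k + k) * (c y - k))
        ≡⟨ ∑-distrib-minus (λ y → c y * c y - k * k) (λ y → (k + k) * (c y - k)) ⟩
      ∑[ y < N ] (c y * c y - k * k) - ∑[ y < N ] ((k + k) * (c y - k))
        ≡⟨ cong₂ _-_ (∑-distrib-minus (λ y → c y * c y) (λ _ → k * k)) (sym (*-distribˡ-sum (k + k) (λ y → c y - k))) ⟩
      ∑[ y < N ] (c y * c y) - ∑[ y < N ] (k * k) - (k + k) * ∑[ y < N ] (c y - k)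
        ≡⟨ cong (λ t → ∑[ y < N ] (c y * c y) - ∑[ y < N ] (k * k) - (k + k) * t) ∑[c-k]≡0 ⟩
      ∑[ y < N ] (c y * c y) - ∑[ y < N ] (k * k) - (k + k) * 0ℤ
        ≡⟨ lemma (∑[ y < N ] (c y * c y)) (∑[ y < N ] (k * k)) (k + k) ⟩
      ∑[ y < N ] (c y * c y) - ∑[ y < N ] (k * k) ∎
      where
      lemma : ∀ a b d → a - b - d * 0ℤ ≡ a - b
      lemma = solve-∀

  row-sum : ∀ x → ∑[ y < N ] M x y ≡ k
  row-sum x = trans (∑-cong N λ y → sym (M-idem x y)) (gram-diagonal x)

  column-sum : ∀ y → ∑[ x < N ] M x y ≡ k
  column-sum y = trans (∑-cong N λ x → sym (M-idem x y)) (c≡k y)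

  D : Matrix N N
  D = X -ᴹ K

  -- Pairs of ones in a common row are counted here, so row sums suffice; `∑₂K` counts pairs in a
  -- common column and is where `column-sum` enters.
  ∑₂X : ∑₂ X ≡ ∑[ x < N ] (k * k)
  ∑₂X = begin
    ∑[ y < N ] ∑[ z < N ] ∑[ x < N ] (M x y * M x z) ≡⟨ (∑-cong N λ y → ∑-comm λ z x → M x y * M x z) ⟩
    ∑[ y < N ] ∑[ x < N ] ∑[ z < N ] (M x y * M x z) ≡⟨ ∑-comm (λ y x → ∑[ z < N ] (M x y * M x z)) ⟩
    ∑[ x < N ] ∑[ y < N ] ∑[ z < N ] (M x y * M x z) ≡⟨ ∑-cong N (λ x → ∑-*-∑ N N (M x) (M x)) ⟨
    ∑[ x < N ] (sum (M x) * sum (M x))               ≡⟨ ∑-cong N (λ x → cong₂ _*_ (row-sum x) (row-sum x)) ⟩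
    ∑[ x < N ] (k * k)                               ∎

  ∑₂K : ∑₂ K ≡ ∑[ x < N ] (k * k)
  ∑₂K = begin
    ∑[ y < N ] ∑[ z < N ] ∑[ x < N ] (M y x * M z x) ≡⟨ (∑-cong N λ y → ∑-comm λ z x → M y x * M z x) ⟩
    ∑[ y < N ] ∑[ x < N ] ∑[ z < N ] (M y x * M z x) ≡⟨ ∑-comm (λ y x → ∑[ z < N ] (M y x * M z x)) ⟩
    ∑[ x < N ] ∑[ y < N ] ∑[ z < N ] (M y x * M z x)
      ≡⟨ ∑-cong N (λ x → ∑-*-∑ N N (λ y → M y x) (λ y → M y x)) ⟨
    ∑[ x < N ] (∑[ y < N ] M y x * ∑[ y < N ] M y x) ≡⟨ ∑-cong N (λ x → cong₂ _*_ (column-sum x) (column-sum x)) ⟩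
    ∑[ x < N ] (k * k)                               ∎

  ∑₂D : ∑₂ D ≡ 0ℤ
  ∑₂D = trans (∑₂-distrib-minus X K) (ℤ.i≡j⇒i-j≡0 (trans ∑₂X (sym ∑₂K)))

  -- `X` and `K` already agree on the diagonal and within classes, so `D` lives where `K` is the
  -- constant `μ`.
  D∘K : ∀ y z → D y z * K y z ≡ μ * D y z
  D∘K y z with y Fin.≟ z
  ... | yes refl = trans (cong (_* K y y) D≡0) (sym (trans (cong (μ *_) D≡0) (ℤ.*-zeroʳ μ)))
    where
    D≡0 : D y y ≡ 0ℤ
    D≡0 = ℤ.i≡j⇒i-j≡0 (trans (c≡k y) (sym (gram-diagonal y)))
  ... | no y≢z with cls y ≟ cls z
  ...   | no neq = trans (cong (D y z *_) (gram-other neq)) (ℤ.*-comm _ μ)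
  ...   | yes eq = trans (cong (_* K y z) D≡0) (sym (trans (cong (μ *_) D≡0) (ℤ.*-zeroʳ μ)))
    where
    D≡0 : D y z ≡ 0ℤ
    D≡0 = ℤ.i≡j⇒i-j≡0 (trans (X-class y≢z eq) (sym (gram-class y≢z eq)))

  -- Squaring X - K gives X² - K² - 2DK entrywise. The first two have equal sums by `⟨X,X⟩`, and the
  -- last is a multiple of `D`, whose sum is 0.
  ∑₂D² : ∑₂ (D ∘ᴹ D) ≡ 0ℤ
  ∑₂D² = begin
    ∑₂ (D ∘ᴹ D)
      ≡⟨ (∑₂-cong N λ y z → trans (expand (X y z) (K y z)) (cong (λ t → X y z * X y z - K y z * K y z - (t + t)) (D∘K y z))) ⟩
    ∑₂ (((X ∘ᴹ X) -ᴹ (K ∘ᴹ K)) -ᴹ (λ y z → μ * D y z + μ * D y z))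
      ≡⟨ (∑₂-cong N λ y z → cong (λ t → X y z * X y z - K y z * K y z - t) (double μ (D y z))) ⟩
    ∑₂ (((X ∘ᴹ X) -ᴹ (K ∘ᴹ K)) -ᴹ (λ y z → (μ + μ) * D y z))
      ≡⟨ ∑₂-distrib-minus ((X ∘ᴹ X) -ᴹ (K ∘ᴹ K)) (λ y z → (μ + μ) * D y z) ⟩
    ∑₂ ((X ∘ᴹ X) -ᴹ (K ∘ᴹ K)) - ∑₂ (λ y z → (μ + μ) * D y z)
      ≡⟨ cong₂ _-_ (trans (∑₂-distrib-minus (X ∘ᴹ X) (K ∘ᴹ K)) (ℤ.i≡j⇒i-j≡0 ⟨X,X⟩))
                   (trans (∑₂-distrib-* (μ + μ) D) (trans (cong ((μ + μ) *_) ∑₂D) (ℤ.*-zeroʳ (μ + μ)))) ⟩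
    0ℤ ∎
    where
    expand : ∀ a b → (a - b) * (a - b) ≡ a * a - b * b - ((a - b) * b + (a - b) * b)
    expand = solve-∀
    double : ∀ a b → a * b + a * b ≡ (a + a) * b
    double = solve-∀

  gram-dual : M ᵀ *ᴹ M ≋ M *ᴹ M ᵀ
  gram-dual y z = ℤ.i-j≡0⇒i≡j _ _ (∑-squares≤0⇒≡0 (D y) (ℤ.≤-reflexive ∑D²y) z)
    where
    ∑D²y : ∑[ z < N ] (D y z * D y z) ≡ 0ℤ
    ∑D²y = ∑≤0⇒≡0 (λ y → ∑[ z < N ] (D y z * D y z))
      (λ y → ∑-nonneg _ λ z → square-nonneg (D y z)) (ℤ.≤-reflexive ∑₂D²) y

-- The group ℤ_n

module _ {n : ℕ} .{{_ : NonZero n}} where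

  toℕ-mod : ∀ a → toℕ (a mod n) ≡ a % n
  toℕ-mod a = Fin.toℕ-fromℕ< (m%n<n a n)

  mod-cong : ∀ {a b} → a % n ≡ b % n → a mod n ≡ b mod n
  mod-cong {a} {b} eq = Fin.toℕ-injective (trans (toℕ-mod a) (trans eq (sym (toℕ-mod b))))

  toℕ-% : ∀ (i : Fin n) → toℕ i % n ≡ toℕ i
  toℕ-% i = m<n⇒m%n≡m (Fin.toℕ<n i)

  mod-toℕ : ∀ (i : Fin n) → toℕ i mod n ≡ i
  mod-toℕ i = Fin.toℕ-injective (trans (toℕ-mod (toℕ i)) (toℕ-% i))

  mod-⊕ : ∀ a b → (a mod n) ⊕ (b mod n) ≡ (a ℕ.+ b) mod n
  mod-⊕ a b = mod-cong (trans (cong₂ (λ s t → (s ℕ.+ t) % n) (toℕ-mod a) (toℕ-mod b)) (sym (%-distribˡ-+ a b n)))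

  ⊕-comm : ∀ (i j : Fin n) → i ⊕ j ≡ j ⊕ i
  ⊕-comm i j = cong (_mod n) (ℕ.+-comm (toℕ i) (toℕ j))

  ⊕-assoc : ∀ (i j k : Fin n) → (i ⊕ j) ⊕ k ≡ i ⊕ (j ⊕ k)
  ⊕-assoc i j k = begin
    (i ⊕ j) ⊕ k                             ≡⟨ cong ((i ⊕ j) ⊕_) (mod-toℕ k) ⟨
    (i ⊕ j) ⊕ (toℕ k mod n)                 ≡⟨ mod-⊕ (toℕ i ℕ.+ toℕ j) (toℕ k) ⟩
    (toℕ i ℕ.+ toℕ j ℕ.+ toℕ k) mod n       ≡⟨ cong (_mod n) (ℕ.+-assoc (toℕ i) (toℕ j) (toℕ k)) ⟩
    (toℕ i ℕ.+ (toℕ j ℕ.+ toℕ k)) mod n     ≡⟨ mod-⊕ (toℕ i) (toℕ j ℕ.+ toℕ k) ⟨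
    (toℕ i mod n) ⊕ (j ⊕ k)                 ≡⟨ cong (_⊕ (j ⊕ k)) (mod-toℕ i) ⟩
    i ⊕ (j ⊕ k)                             ∎
    where open ≡-Reasoning

  ⊕-identityˡ : ∀ (i : Fin n) → 0̄ ⊕ i ≡ i
  ⊕-identityˡ i = trans (cong (0̄ ⊕_) (sym (mod-toℕ i))) (trans (mod-⊕ 0 (toℕ i)) (mod-toℕ i))

  ⊕-inverseʳ : ∀ (i : Fin n) → i ⊖ i ≡ 0̄
  ⊕-inverseʳ i = begin
    i ⊕ (⊖ i)                         ≡⟨ cong (_⊕ (⊖ i)) (mod-toℕ i) ⟨
    (toℕ i mod n) ⊕ (⊖ i)             ≡⟨ mod-⊕ (toℕ i) (n ℕ.∸ toℕ i) ⟩
    (toℕ i ℕ.+ (n ℕ.∸ toℕ i)) mod n   ≡⟨ cong (_mod n) (ℕ.m+[n∸m]≡n (ℕ.<⇒≤ (Fin.toℕ<n i))) ⟩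
    n mod n                           ≡⟨ mod-cong (trans (n%n≡0 n) (sym (m<n⇒m%n≡m (ℕ.>-nonZero⁻¹ n)))) ⟩
    0̄                                 ∎
    where open ≡-Reasoning

-- Bundled to borrow the cancellation and inversion laws of abelian groups.
ℤₙ : (n : ℕ) .{{_ : NonZero n}} → AbelianGroup _ _
ℤₙ n = record
  { Carrier = Fin n ; _≈_ = _≡_ ; _∙_ = _⊕_ ; ε = 0̄ ; _⁻¹ = λ i → ⊖ i
  ; isAbelianGroup = record
    { isGroup = record
      { isMonoid = record
        { isSemigroup = record
          { isMagma = record { isEquivalence = isEquivalence ; ∙-cong = cong₂ _⊕_ }
          ; assoc = ⊕-assoc }
        ; identity = ⊕-identityˡ , λ i → trans (⊕-comm i 0̄) (⊕-identityˡ i) }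
      ; inverse = (λ i → trans (⊕-comm (⊖ i) i) (⊕-inverseʳ i)) , ⊕-inverseʳ
      ; ⁻¹-cong = cong (λ i → ⊖ i) }
    ; comm = ⊕-comm } }

module _ {n : ℕ} .{{_ : NonZero n}} where

  open AbelianGroup (ℤₙ n) using () renaming (identityʳ to ⊕-identityʳ) public
  open AbelianGroupProperties (ℤₙ n) using ()
    renaming ( ⁻¹-involutive to ⊖-involutive; ⁻¹-anti-homo‿- to ⊖-anti-homo-⊖; ⁻¹-∙-comm to ⊖-⊕-comm
             ; //-rightDividesˡ to [i⊖j]⊕j≡i; //-rightDividesʳ to [i⊕j]⊖j≡i
             ; x∙y⁻¹≈ε⇒x≈y to i⊖j≡0̄⇒i≡j; ∙-cancelˡ to ⊕-cancelˡ; ε⁻¹≈ε to ⊖0̄≡0̄) public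

  ⊖-swap : ∀ (i j k : Fin n) → (i ⊖ j) ⊖ k ≡ (i ⊖ k) ⊖ j
  ⊖-swap i j k = trans (⊕-assoc i (⊖ j) (⊖ k))
    (trans (cong (i ⊕_) (⊕-comm (⊖ j) (⊖ k))) (sym (⊕-assoc i (⊖ k) (⊖ j))))

  ⊕-⊖-swap : ∀ (i j k : Fin n) → (i ⊕ j) ⊖ k ≡ (i ⊖ k) ⊕ j
  ⊕-⊖-swap i j k = trans (⊕-assoc i j (⊖ k))
    (trans (cong (i ⊕_) (⊕-comm j (⊖ k))) (sym (⊕-assoc i (⊖ k) j)))

  i⊖[j⊕k]≡[i⊖j]⊖k : ∀ (i j k : Fin n) → i ⊖ (j ⊕ k) ≡ (i ⊖ j) ⊖ k
  i⊖[j⊕k]≡[i⊖j]⊖k i j k = trans (cong (i ⊕_) (sym (⊖-⊕-comm j k))) (sym (⊕-assoc i (⊖ j) (⊖ k)))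

  i⊖[j⊖k]≡[i⊖j]⊕k : ∀ (i j k : Fin n) → i ⊖ (j ⊖ k) ≡ (i ⊖ j) ⊕ k
  i⊖[j⊖k]≡[i⊖j]⊕k i j k = trans (i⊖[j⊕k]≡[i⊖j]⊖k i j (⊖ k)) (cong ((i ⊖ j) ⊕_) (⊖-involutive k))

  i⊖j≡k⇒i≡k⊕j : ∀ (i j k : Fin n) → i ⊖ j ≡ k → i ≡ k ⊕ j
  i⊖j≡k⇒i≡k⊕j i j k eq = trans (sym ([i⊖j]⊕j≡i j i)) (cong (_⊕ j) eq)

  i≡k⊕j⇒i⊖j≡k : ∀ (i j k : Fin n) → i ≡ k ⊕ j → i ⊖ j ≡ k
  i≡k⊕j⇒i⊖j≡k i j k eq = trans (cong (_⊖ j) eq) ([i⊕j]⊖j≡i j k)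

  toℕ-1̄ : 2 ℕ.≤ n → toℕ (1 mod n) ≡ 1
  toℕ-1̄ 2≤n = trans (toℕ-mod 1) (m<n⇒m%n≡m 2≤n)

  1̄≢0̄ : 2 ℕ.≤ n → 1 mod n ≢ 0̄
  1̄≢0̄ 2≤n eq with trans (sym (toℕ-1̄ 2≤n)) (trans (cong toℕ eq) (trans (toℕ-mod 0) (m<n⇒m%n≡m (ℕ.>-nonZero⁻¹ n))))
  ... | ()

  -- A factor `P` on the left replaces row `a` by row 1̄ ⊕ a. The defining row of `P` has its 1
  -- where `toℕ` equals 1, and n ≥ 2 makes that position `1 mod n`.
  P-power-entry : 2 ℕ.≤ n → ∀ e (a b : Fin n) → (P n ^ᴹ e) a b ≡ indicator ((b ⊖ a) Fin.≟ (e mod n))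
  P-power-entry 2≤n zero a b =
    indicator-⇔ (λ { refl → ⊕-inverseʳ a }) (λ eq → sym (i⊖j≡0̄⇒i≡j b a eq)) (a Fin.≟ b) ((b ⊖ a) Fin.≟ (0 mod n))
  P-power-entry 2≤n (suc e) a b = begin
    ∑[ l < n ] (indicator (toℕ (l ⊖ a) ℕ.≟ 1) * (P n ^ᴹ e) l b)
      ≡⟨ ∑-unique (λ l → toℕ (l ⊖ a) ℕ.≟ 1) (1̄ ⊕ a)
           (trans (cong toℕ ([i⊕j]⊖j≡i a 1̄)) (toℕ-1̄ 2≤n))
           (λ l eq → i⊖j≡k⇒i≡k⊕j l a 1̄ (Fin.toℕ-injective (trans eq (sym (toℕ-1̄ 2≤n)))))
           (λ l → (P n ^ᴹ e) l b) ⟩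
    (P n ^ᴹ e) (1̄ ⊕ a) b
      ≡⟨ P-power-entry 2≤n e (1̄ ⊕ a) b ⟩
    indicator ((b ⊖ (1̄ ⊕ a)) Fin.≟ (e mod n))
      ≡⟨ indicator-⇔ (λ eq → trans (i⊖j≡k⇒i≡k⊕j (b ⊖ a) 1̄ (e mod n) (trans (sym step) eq)) e+1)
                     (λ eq → trans step (i≡k⊕j⇒i⊖j≡k (b ⊖ a) 1̄ (e mod n) (trans eq (sym e+1))))
                     ((b ⊖ (1̄ ⊕ a)) Fin.≟ (e mod n)) ((b ⊖ a) Fin.≟ (suc e mod n)) ⟩
    indicator ((b ⊖ a) Fin.≟ (suc e mod n)) ∎
    where
    open ≡-Reasoning
    1̄ = 1 mod n
    step : b ⊖ (1̄ ⊕ a) ≡ (b ⊖ a) ⊖ 1̄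
    step = trans (cong (λ t → b ⊖ t) (⊕-comm 1̄ a)) (i⊖[j⊕k]≡[i⊖j]⊖k b a 1̄)
    e+1 : (e mod n) ⊕ 1̄ ≡ suc e mod n
    e+1 = trans (mod-⊕ e 1) (cong (_mod n) (ℕ.+-comm e 1))

  P-power-entry-toℕ : 2 ℕ.≤ n → ∀ (i a b : Fin n) → (P n ^ᴹ toℕ i) a b ≡ indicator ((b ⊖ a) Fin.≟ i)
  P-power-entry-toℕ 2≤n i a b = trans (P-power-entry 2≤n (toℕ i) a b)
    (cong (λ t → indicator ((b ⊖ a) Fin.≟ t)) (mod-toℕ i))

-- Colours

-- rot i, one, two i and three are the colours of A₀ i, A₁, A₂ i and A₃.
data Label (n : ℕ) : Set where
  rot   : Fin n → Label n
  one   : Label n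
  two   : Fin n → Label n
  three : Label n

rot-injective : {i j : Fin n} → rot i ≡ rot j → i ≡ j
rot-injective refl = refl

two-injective : {i j : Fin n} → two i ≡ two j → i ≡ j
two-injective refl = refl

infix 4 _≟ᴸ_
_≟ᴸ_ : DecidableEquality (Label n)
rot i ≟ᴸ rot j = map′ (cong rot) rot-injective (i Fin.≟ j)
rot _ ≟ᴸ one   = no λ ()
rot _ ≟ᴸ two _ = no λ ()
rot _ ≟ᴸ three = no λ ()
one   ≟ᴸ rot _ = no λ ()
one   ≟ᴸ one   = yes refl
one   ≟ᴸ two _ = no λ ()
one   ≟ᴸ three = no λ ()
two _ ≟ᴸ rot _ = no λ ()
two _ ≟ᴸ one   = no λ ()
two i ≟ᴸ two j = map′ (cong two) two-injective (i Fin.≟ j)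
two _ ≟ᴸ three = no λ ()
three ≟ᴸ rot _ = no λ ()
three ≟ᴸ one   = no λ ()
three ≟ᴸ two _ = no λ ()
three ≟ᴸ three = yes refl

-- Whether the two points of a pair with this label lie in different halves.
crosses : Label n → Bool
crosses (rot _) = false
crosses one     = false
crosses (two _) = true
crosses three   = true

module _ {n : ℕ} .{{_ : NonZero n}} where

  reverse : Label n → Label n
  reverse (rot i) = rot (⊖ i)
  reverse one     = one
  reverse (two i) = two (⊖ i)
  reverse three   = three

  -- Effect of translating the first point by `i`. The signs differ because the ℤ_n coordinate of
  -- the first point enters `rot` negatively and `two` positively.
  shift : Fin n → Label n → Label n
  shift i (rot j) = rot (j ⊖ i)
  shift i one     = one
  shift i (two j) = two (j ⊕ i)
  shift i three   = three

  reverse-involutive : ∀ ℓ → reverse (reverse ℓ) ≡ ℓ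
  reverse-involutive (rot i) = cong rot (⊖-involutive i)
  reverse-involutive one     = refl
  reverse-involutive (two i) = cong two (⊖-involutive i)
  reverse-involutive three   = refl

  reverse-shift-reverse : ∀ i ℓ → reverse (shift i (reverse ℓ)) ≡ shift (⊖ i) ℓ
  reverse-shift-reverse i (rot j) = cong rot (trans (sym (⊖-⊕-comm (⊖ j) (⊖ i))) (cong (_⊕ (⊖ (⊖ i))) (⊖-involutive j)))
  reverse-shift-reverse i one     = refl
  reverse-shift-reverse i (two j) = cong two (trans (sym (⊖-⊕-comm (⊖ j) i)) (cong (_⊕ (⊖ i)) (⊖-involutive j)))
  reverse-shift-reverse i three   = refl

  shift-comm : ∀ i j ℓ → shift i (shift j ℓ) ≡ shift j (shift i ℓ)
  shift-comm i j (rot t) = cong rot (⊖-swap t j i)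
  shift-comm i j one     = refl
  shift-comm i j (two t) = cong two (trans (⊕-assoc t j i) (trans (cong (t ⊕_) (⊕-comm j i)) (sym (⊕-assoc t i j))))
  shift-comm i j three   = refl

  shift-⊖-two⇒ : ∀ i ℓ → shift (⊖ i) ℓ ≡ two 0̄ → ℓ ≡ two i
  shift-⊖-two⇒ i (two j) eq = cong two (i⊖j≡0̄⇒i≡j j i (two-injective eq))

  shift-⊖-two : ∀ i → shift (⊖ i) (two i) ≡ two 0̄
  shift-⊖-two i = cong two (⊕-inverseʳ i)

-- Points and matrix indices

Point : ℕ → ℕ → Set
Point n v = (Fin n × Fin v) ⊎ (Fin n × Fin v)

-- Follows the `splitAt` and `remQuot` through which `block` and `_⊗_` read their indices, so that
-- one case split on `splitAt` reduces matrix entries and labels together.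
locate : (Fin (n ℕ.* v) ⊎ Fin (n ℕ.* v)) → Point n v
locate {n} {v} = Sum.map (remQuot {n} v) (remQuot {n} v)

locate⁻¹ : Point n v → (Fin (n ℕ.* v) ⊎ Fin (n ℕ.* v))
locate⁻¹ = Sum.map (uncurry combine) (uncurry combine)

decode : Fin (n ℕ.* v ℕ.+ n ℕ.* v) → Point n v
decode {n} {v} x = locate {n} {v} (splitAt (n ℕ.* v) x)

encode : Point n v → Fin (n ℕ.* v ℕ.+ n ℕ.* v)
encode {n} {v} x = Fin.join (n ℕ.* v) (n ℕ.* v) (locate⁻¹ x)

decode-encode : (x : Point n v) → decode {n} {v} (encode x) ≡ x
decode-encode {n} {v} x = trans (cong (locate {n} {v}) (Fin.splitAt-join (n ℕ.* v) (n ℕ.* v) (locate⁻¹ x))) (lemma x)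
  where
  lemma : ∀ x → locate {n} {v} (locate⁻¹ x) ≡ x
  lemma (inj₁ (i , a)) = cong inj₁ (Fin.remQuot-combine {n} i a)
  lemma (inj₂ (i , a)) = cong inj₂ (Fin.remQuot-combine {n} i a)

encode-decode : (x : Fin (n ℕ.* v ℕ.+ n ℕ.* v)) → encode (decode {n} {v} x) ≡ x
encode-decode {n} {v} x = trans (cong (Fin.join (n ℕ.* v) (n ℕ.* v)) (lemma (splitAt (n ℕ.* v) x)))
                        (Fin.join-splitAt (n ℕ.* v) (n ℕ.* v) x)
  where
  lemma : ∀ s → locate⁻¹ (locate {n} {v} s) ≡ s
  lemma (inj₁ i) = cong inj₁ (Fin.combine-remQuot {n} v i)
  lemma (inj₂ i) = cong inj₂ (Fin.combine-remQuot {n} v i)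

decode-injective : ∀ {x y} → decode {n} {v} x ≡ decode y → x ≡ y
decode-injective {n} {v} {x} {y} eq = trans (sym (encode-decode {n} {v} x)) (trans (cong encode eq) (encode-decode {n} {v} y))

module Coloring {n v : ℕ} .{{_ : NonZero n}} (W : EntryMatrix n v) where

  N : ℕ
  N = n ℕ.* v ℕ.+ n ℕ.* v

  rq : Fin (n ℕ.* v) → Fin n × Fin v
  rq = remQuot {n} v

  -- The decision is an argument so that lemmas can split on it without abstracting it in a goal.
  sameLabel : {a b : Fin v} → Dec (a ≡ b) → Fin n → Label n
  sameLabel (yes _) i = rot i
  sameLabel (no _)  i = one

  -- At (p, q) only the power j = q - p of `P` contributes. The upper block of A₂ i then asks w = i
  -- + j and the lower one w = -i - j; the formulas after `two` solve these for i.
  pointLabel : Point n v → Point n v → Label n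
  pointLabel (inj₁ (p , a)) (inj₁ (q , b)) = sameLabel (a Fin.≟ b) (q ⊖ p)
  pointLabel (inj₁ (p , a)) (inj₂ (q , b)) = maybe′ (λ w → two (w ⊖ (q ⊖ p))) three (W a b)
  pointLabel (inj₂ (p , a)) (inj₁ (q , b)) = maybe′ (λ w → two ((p ⊖ q) ⊖ w)) three (W b a)
  pointLabel (inj₂ (p , a)) (inj₂ (q , b)) = sameLabel (a Fin.≟ b) (q ⊖ p)

  rotate : Fin n → Point n v → Point n v
  rotate i (inj₁ (p , a)) = inj₁ (p ⊕ i , a)
  rotate i (inj₂ (p , a)) = inj₂ (p ⊕ i , a)

  sameLabel-swap : ∀ a b (i : Fin n) → sameLabel (b Fin.≟ a) (⊖ i) ≡ reverse (sameLabel (a Fin.≟ b) i)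
  sameLabel-swap a b i with b Fin.≟ a | a Fin.≟ b
  ... | yes _  | yes _  = refl
  ... | no _   | no _   = refl
  ... | yes eq | no neq = contradiction (sym eq) neq
  ... | no neq | yes eq = contradiction (sym eq) neq

  pointLabel-swap : ∀ x y → pointLabel y x ≡ reverse (pointLabel x y)
  pointLabel-swap (inj₁ (p , a)) (inj₁ (q , b)) =
    trans (cong (sameLabel (b Fin.≟ a)) (sym (⊖-anti-homo-⊖ q p))) (sameLabel-swap a b (q ⊖ p))
  pointLabel-swap (inj₁ (p , a)) (inj₂ (q , b)) with W a b
  ... | just w  = cong two (sym (⊖-anti-homo-⊖ w (q ⊖ p)))
  ... | nothing = refl
  pointLabel-swap (inj₂ (p , a)) (inj₁ (q , b)) with W b a
  ... | just w  = cong two (sym (⊖-anti-homo-⊖ (p ⊖ q) w))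
  ... | nothing = refl
  pointLabel-swap (inj₂ (p , a)) (inj₂ (q , b)) =
    trans (cong (sameLabel (b Fin.≟ a)) (sym (⊖-anti-homo-⊖ q p))) (sameLabel-swap a b (q ⊖ p))

  sameLabel-shift : ∀ {a b} (a≟b : Dec (a ≡ b)) (p q i : Fin n) →
                    sameLabel a≟b (q ⊖ (p ⊕ i)) ≡ shift i (sameLabel a≟b (q ⊖ p))
  sameLabel-shift (yes _) p q i = cong rot (i⊖[j⊕k]≡[i⊖j]⊖k q p i)
  sameLabel-shift (no _)  p q i = refl

  pointLabel-rotate : ∀ i x y → pointLabel (rotate i x) y ≡ shift i (pointLabel x y)
  pointLabel-rotate i (inj₁ (p , a)) (inj₁ (q , b)) = sameLabel-shift (a Fin.≟ b) p q i
  pointLabel-rotate i (inj₁ (p , a)) (inj₂ (q , b)) with W a b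
  ... | just w  = cong two (trans (cong (λ t → w ⊖ t) (i⊖[j⊕k]≡[i⊖j]⊖k q p i)) (i⊖[j⊖k]≡[i⊖j]⊕k w (q ⊖ p) i))
  ... | nothing = refl
  pointLabel-rotate i (inj₂ (p , a)) (inj₁ (q , b)) with W b a
  ... | just w  = cong two (trans (cong (_⊖ w) (⊕-⊖-swap p i q)) (⊕-⊖-swap (p ⊖ q) i w))
  ... | nothing = refl
  pointLabel-rotate i (inj₂ (p , a)) (inj₂ (q , b)) = sameLabel-shift (a Fin.≟ b) p q i

  sameLabel-refl : ∀ a (i : Fin n) → sameLabel (a Fin.≟ a) i ≡ rot i
  sameLabel-refl a i with a Fin.≟ a
  ... | yes _  = refl
  ... | no neq = contradiction refl neq

  sameLabel-rot⇒ : ∀ {a b} (a≟b : Dec (a ≡ b)) (p q i : Fin n) →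
                   sameLabel a≟b (q ⊖ p) ≡ rot i → (q , b) ≡ (p ⊕ i , a)
  sameLabel-rot⇒ (yes refl) p q i eq =
    cong (_, _) (trans (i⊖j≡k⇒i≡k⊕j q p i (rot-injective eq)) (⊕-comm i p))

  pointLabel-rot : ∀ i x → pointLabel x (rotate i x) ≡ rot i
  pointLabel-rot i (inj₁ (p , a)) = trans (sameLabel-refl a _) (cong rot (trans (cong (_⊖ p) (⊕-comm p i)) ([i⊕j]⊖j≡i p i)))
  pointLabel-rot i (inj₂ (p , a)) = trans (sameLabel-refl a _) (cong rot (trans (cong (_⊖ p) (⊕-comm p i)) ([i⊕j]⊖j≡i p i)))

  pointLabel-rot⇒ : ∀ i x y → pointLabel x y ≡ rot i → y ≡ rotate i x
  pointLabel-rot⇒ i (inj₁ (p , a)) (inj₁ (q , b)) eq = cong inj₁ (sameLabel-rot⇒ (a Fin.≟ b) p q i eq)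
  pointLabel-rot⇒ i (inj₁ (p , a)) (inj₂ (q , b)) eq with W a b
  pointLabel-rot⇒ i (inj₁ (p , a)) (inj₂ (q , b)) () | just _
  pointLabel-rot⇒ i (inj₁ (p , a)) (inj₂ (q , b)) () | nothing
  pointLabel-rot⇒ i (inj₂ (p , a)) (inj₁ (q , b)) eq with W b a
  pointLabel-rot⇒ i (inj₂ (p , a)) (inj₁ (q , b)) () | just _
  pointLabel-rot⇒ i (inj₂ (p , a)) (inj₁ (q , b)) () | nothing
  pointLabel-rot⇒ i (inj₂ (p , a)) (inj₂ (q , b)) eq = cong inj₂ (sameLabel-rot⇒ (a Fin.≟ b) p q i eq)

  half : Point n v → Bool
  half (inj₁ _) = false
  half (inj₂ _) = true

  crosses-sameLabel : ∀ {a b} (a≟b : Dec (a ≡ b)) (i : Fin n) → crosses (sameLabel a≟b i) ≡ false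
  crosses-sameLabel (yes _) i = refl
  crosses-sameLabel (no _)  i = refl

  crosses-pointLabel : ∀ x y → crosses (pointLabel x y) ≡ half x xor half y
  crosses-pointLabel (inj₁ (p , a)) (inj₁ (q , b)) = crosses-sameLabel (a Fin.≟ b) (q ⊖ p)
  crosses-pointLabel (inj₁ (p , a)) (inj₂ (q , b)) with W a b
  ... | just _  = refl
  ... | nothing = refl
  crosses-pointLabel (inj₂ (p , a)) (inj₁ (q , b)) with W b a
  ... | just _  = refl
  ... | nothing = refl
  crosses-pointLabel (inj₂ (p , a)) (inj₂ (q , b)) = crosses-sameLabel (a Fin.≟ b) (q ⊖ p)

  label : Fin N → Fin N → Label n
  label x y = pointLabel (decode x) (decode y)

  T : Fin n → Fin N → Fin N
  T i x = encode (rotate i (decode x))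

  label-swap : ∀ x y → label y x ≡ reverse (label x y)
  label-swap x y = pointLabel-swap (decode x) (decode y)

  label-Tˡ : ∀ i x y → label (T i x) y ≡ shift i (label x y)
  label-Tˡ i x y = trans (cong (λ z → pointLabel z (decode y)) (decode-encode (rotate i (decode x))))
                         (pointLabel-rotate i (decode x) (decode y))

  -- Translating the second point is translating the first point of the reversed pair.
  label-Tʳ : ∀ i x y → label x (T i y) ≡ shift (⊖ i) (label x y)
  label-Tʳ i x y = begin
    label x (T i y)                      ≡⟨ label-swap (T i y) x ⟩
    reverse (label (T i y) x)            ≡⟨ cong reverse (label-Tˡ i y x) ⟩
    reverse (shift i (label y x))        ≡⟨ cong (reverse ∘ shift i) (label-swap x y) ⟩
    reverse (shift i (reverse (label x y))) ≡⟨ reverse-shift-reverse i (label x y) ⟩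
    shift (⊖ i) (label x y)              ∎
    where open ≡-Reasoning

  label-rot : ∀ i x → label x (T i x) ≡ rot i
  label-rot i x = trans (cong (pointLabel (decode x)) (decode-encode (rotate i (decode x))))
                        (pointLabel-rot i (decode x))

  label-rot⇒ : ∀ i x y → label x y ≡ rot i → y ≡ T i x
  label-rot⇒ i x y eq = decode-injective {n} {v} (trans (pointLabel-rot⇒ i (decode x) (decode y) eq)
                                                (sym (decode-encode (rotate i (decode x)))))

  label-rotʳ : ∀ i y → label (T (⊖ i) y) y ≡ rot i
  label-rotʳ i y = trans (label-swap y (T (⊖ i) y))
    (trans (cong reverse (label-rot (⊖ i) y)) (cong rot (⊖-involutive i)))

  label-rotʳ⇒ : ∀ i x y → label x y ≡ rot i → x ≡ T (⊖ i) y
  label-rotʳ⇒ i x y eq = label-rot⇒ (⊖ i) y x (trans (label-swap x y) (cong reverse eq))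

  half′ : Fin N → Bool
  half′ x = half (decode x)

  crosses-label : ∀ x y → crosses (label x y) ≡ half′ x xor half′ y
  crosses-label x y = crosses-pointLabel (decode x) (decode y)

  crosses-label-triangle : ∀ x z y → crosses (label x z) xor crosses (label z y) ≡ crosses (label x y)
  crosses-label-triangle x z y = trans (cong₂ _xor_ (crosses-label x z) (crosses-label z y))
    (trans (lemma (half′ x) (half′ z) (half′ y)) (sym (crosses-label x y)))
    where
    lemma : ∀ a b c → (a xor b) xor (b xor c) ≡ a xor c
    lemma false false c     = refl
    lemma false true  false = refl
    lemma false true  true  = refl
    lemma true  false c     = refl
    lemma true  true  c     = refl

  crosses-label-swap : ∀ x y → crosses (label y x) ≡ crosses (label x y)
  crosses-label-swap x y = trans (crosses-label y x) (trans (Bool.xor-comm (half′ y) (half′ x)) (sym (crosses-label x y)))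

-- Products of colour matrices

*ᴹ-cong : {A A′ : Matrix p q} {C C′ : Matrix q r} → A ≋ A′ → C ≋ C′ → A *ᴹ C ≋ A′ *ᴹ C′
*ᴹ-cong {q = q} A≋ C≋ x y = ∑-cong q λ l → cong₂ _*_ (A≋ x l) (C≋ l y)

*ᴹ-distribʳ-minus : (A A′ : Matrix p q) (C : Matrix q r) → (A -ᴹ A′) *ᴹ C ≋ (A *ᴹ C) -ᴹ (A′ *ᴹ C)
*ᴹ-distribʳ-minus {q = q} A A′ C x y = trans (∑-cong q λ l → lemma (A x l) (A′ x l) (C l y))
                                      (∑-distrib-minus (λ l → A x l * C l y) (λ l → A′ x l * C l y))
  where
  lemma : ∀ a b c → (a - b) * c ≡ a * c - b * c
  lemma = solve-∀

*ᴹ-distribˡ-minus : (A : Matrix p q) (C C′ : Matrix q r) → A *ᴹ (C -ᴹ C′) ≋ (A *ᴹ C) -ᴹ (A *ᴹ C′)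
*ᴹ-distribˡ-minus {q = q} A C C′ x y = trans (∑-cong q λ l → lemma (A x l) (C l y) (C′ l y))
                                      (∑-distrib-minus (λ l → A x l * C l y) (λ l → A x l * C′ l y))
  where
  lemma : ∀ a b c → a * (b - c) ≡ a * b - a * c
  lemma = solve-∀

*ᴹ-distribʳ-∑ : (A : Vector (Matrix p q) m) (C : Matrix q r) → ∑ᴹ A *ᴹ C ≋ ∑ᴹ (λ i → A i *ᴹ C)
*ᴹ-distribʳ-∑ {q = q} A C x y = trans (∑-cong q λ l → *-distribʳ-sum (C l y) (λ i → A i x l))
                                      (∑-comm λ l i → A i x l * C l y)

*ᴹ-distribˡ-∑ : (C : Matrix p q) (A : Vector (Matrix q r) m) → C *ᴹ ∑ᴹ A ≋ ∑ᴹ (λ i → C *ᴹ A i)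
*ᴹ-distribˡ-∑ {q = q} C A x y = trans (∑-cong q λ l → *-distribˡ-sum (C x l) (λ i → A i l y))
                                      (∑-comm λ l i → C x l * A i l y)

module Products {n v : ℕ} .{{_ : NonZero n}} (W : EntryMatrix n v) where

  open Coloring W

  mat : Label n → Matrix N N
  mat ℓ x y = indicator (label x y ≟ᴸ ℓ)

  -- Membership in the span as dependence on the label only. Values of `coeff` at labels that do not
  -- occur are arbitrary, so the same notion serves with and without `three`.
  record InSpan (A : Matrix N N) : Set where
    constructor inSpan
    field
      coeff  : Label n → ℤ
      expand : ∀ x y → A x y ≡ coeff (label x y)

  -- Both conditions pass through differences and sums in the left factor, which is how `mat one`
  -- and `mat three` are reached; hence they travel together.
  record Compatible (A C : Matrix N N) : Set where
    constructor compatible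
    field
      span : InSpan (A *ᴹ C)
      comm : A *ᴹ C ≋ C *ᴹ A

  open InSpan
  open Compatible

  mat-InSpan : ∀ ℓ → InSpan (mat ℓ)
  mat-InSpan ℓ = inSpan (λ ℓ′ → indicator (ℓ′ ≟ᴸ ℓ)) λ x y → refl

  InSpan-cong : ∀ {A C} → A ≋ C → InSpan C → InSpan A
  InSpan-cong A≋C (inSpan coeff C≡) = inSpan coeff λ x y → trans (A≋C x y) (C≡ x y)

  Compatible-sym : ∀ {A C} → Compatible A C → Compatible C A
  Compatible-sym {A} {C} (compatible span comm) =
    compatible (InSpan-cong (λ x y → sym (comm x y)) span) (λ x y → sym (comm x y))

  Compatible-congˡ : ∀ {A A′ C} → A ≋ A′ → Compatible A′ C → Compatible A C
  Compatible-congˡ {A} {A′} {C} A≋ (compatible span comm) = compatible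
    (InSpan-cong (*ᴹ-cong {A = A} {A′} {C} {C} A≋ (λ _ _ → refl)) span)
    λ x y → trans (*ᴹ-cong {A = A} {A′} {C} {C} A≋ (λ _ _ → refl) x y)
              (trans (comm x y) (sym (*ᴹ-cong {A = C} {C} {A} {A′} (λ _ _ → refl) A≋ x y)))

  Compatible-minus : ∀ {A A′ C} → Compatible A C → Compatible A′ C → Compatible (A -ᴹ A′) C
  Compatible-minus {A} {A′} {C} (compatible (inSpan f f≡) comm) (compatible (inSpan g g≡) comm′) = compatible
    (inSpan (λ ℓ → f ℓ - g ℓ) λ x y → trans (*ᴹ-distribʳ-minus A A′ C x y) (cong₂ _-_ (f≡ x y) (g≡ x y)))
    λ x y → trans (*ᴹ-distribʳ-minus A A′ C x y)
              (trans (cong₂ _-_ (comm x y) (comm′ x y)) (sym (*ᴹ-distribˡ-minus C A A′ x y)))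

  Compatible-∑ : {A : Vector (Matrix N N) m} {C : Matrix N N} →
                 (∀ i → Compatible (A i) C) → Compatible (∑ᴹ A) C
  Compatible-∑ {m} {A} {C} good = compatible
    (inSpan (λ ℓ → ∑[ i < m ] coeff (span (good i)) ℓ)
            λ x y → trans (*ᴹ-distribʳ-∑ A C x y) (∑-cong m λ i → expand (span (good i)) x y))
    λ x y → trans (*ᴹ-distribʳ-∑ A C x y)
              (trans (∑-cong m λ i → comm (good i) x y) (sym (*ᴹ-distribˡ-∑ C A x y)))

  mat-rot-*ˡ : ∀ i (A : Matrix N N) x y → (mat (rot i) *ᴹ A) x y ≡ A (T i x) y
  mat-rot-*ˡ i A x y = ∑-unique (λ z → label x z ≟ᴸ rot i) (T i x) (label-rot i x)
                                (λ z → label-rot⇒ i x z) (λ z → A z y)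

  mat-rot-*ʳ : ∀ i (A : Matrix N N) x y → (A *ᴹ mat (rot i)) x y ≡ A x (T (⊖ i) y)
  mat-rot-*ʳ i A x y = trans (∑-cong N λ z → ℤ.*-comm (A x z) (mat (rot i) z y))
    (∑-unique (λ z → label z y ≟ᴸ rot i) (T (⊖ i) y) (label-rotʳ i y)
              (λ z → label-rotʳ⇒ i z y) (λ z → A x z))

  -- The product on the left translates the first point by `i`, the one on the right translates the
  -- second by ⊖ i; on labels both are `shift i`.
  rot-Compatible : ∀ i {A} → InSpan A → Compatible (mat (rot i)) A
  rot-Compatible i {A} (inSpan f A≡) = compatible
    (inSpan (λ ℓ → f (shift i ℓ)) left) λ x y → trans (left x y) (sym (right x y))
    where
    open ≡-Reasoning
    left : ∀ x y → (mat (rot i) *ᴹ A) x y ≡ f (shift i (label x y))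
    left x y = begin
      (mat (rot i) *ᴹ A) x y  ≡⟨ mat-rot-*ˡ i A x y ⟩
      A (T i x) y             ≡⟨ A≡ (T i x) y ⟩
      f (label (T i x) y)     ≡⟨ cong f (label-Tˡ i x y) ⟩
      f (shift i (label x y)) ∎
    right : ∀ x y → (A *ᴹ mat (rot i)) x y ≡ f (shift i (label x y))
    right x y = begin
      (A *ᴹ mat (rot i)) x y          ≡⟨ mat-rot-*ʳ i A x y ⟩
      A x (T (⊖ i) y)                 ≡⟨ A≡ x (T (⊖ i) y) ⟩
      f (label x (T (⊖ i) y))         ≡⟨ cong f (label-Tʳ (⊖ i) x y) ⟩
      f (shift (⊖ (⊖ i)) (label x y)) ≡⟨ cong (λ t → f (shift t (label x y))) (⊖-involutive i) ⟩
      f (shift i (label x y))         ∎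

  -- Block all-ones matrices and regular matrices

  E : Bool → Matrix N N
  E s x y = indicator (crosses (label x y) Bool.≟ s)

  record Regular (s : Bool) (σ : ℤ) (A : Matrix N N) : Set where
    field
      support : ∀ x y → E s x y * A x y ≡ A x y
      rows    : ∀ x → ∑[ z < N ] A x z ≡ σ
      columns : ∀ y → ∑[ z < N ] A z y ≡ σ

  xor-cancelʳ : ∀ a b → (a xor b) xor b ≡ a
  xor-cancelʳ false false = refl
  xor-cancelʳ false true  = refl
  xor-cancelʳ true  false = refl
  xor-cancelʳ true  true  = refl

  -- Crossing types add along a triangle, so once the type of z, y is fixed, the types of x, z and
  -- of x, y determine each other.
  E-Eʳ : ∀ s t x z y → E s z y * E t x z ≡ E s z y * E (t xor s) x y
  E-Eʳ s t x z y = indicator-*-cong (crosses (label z y) Bool.≟ s) λ zy≡s → indicator-⇔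
    (λ xz≡t → trans (sym (crosses-label-triangle x z y)) (cong₂ _xor_ xz≡t zy≡s))
    (λ xy≡ → trans (sym (xor-cancelʳ (crosses (label x z)) s))
      (trans (cong (_xor s) (trans (cong (crosses (label x z) xor_) (sym zy≡s))
                                   (trans (crosses-label-triangle x z y) xy≡))) (xor-cancelʳ t s)))
    (crosses (label x z) Bool.≟ t) (crosses (label x y) Bool.≟ (t xor s))

  E-swap : ∀ s x y → E s y x ≡ E s x y
  E-swap s x y = cong (λ c → indicator (c Bool.≟ s)) (crosses-label-swap x y)

  E-Eˡ : ∀ s t x z y → E s x z * E t z y ≡ E s x z * E (t xor s) x y
  E-Eˡ s t x z y = trans (cong₂ _*_ (E-swap s z x) (E-swap t y z))
    (trans (E-Eʳ s t y z x) (cong₂ _*_ (E-swap s x z) (E-swap (t xor s) x y)))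

  -- On the support of `A` the factor `E t x z` can be traded for `E (t xor s) x y`, which is free
  -- of `z`; what remains is a column sum.
  E-*-Regular : ∀ t {s σ A} → Regular s σ A → ∀ x y → (E t *ᴹ A) x y ≡ E (t xor s) x y * σ
  E-*-Regular t {s} {σ} {A} reg x y = begin
    ∑[ z < N ] (E t x z * A z y)
      ≡⟨ ∑-cong N (λ z → trans (cong (E t x z *_) (sym (support z y))) (trans (flip-* (E t x z) (E s z y) (A z y))
           (trans (cong (_* A z y) (E-Eʳ s t x z y))
           (trans (flip-*′ (E s z y) (E (t xor s) x y) (A z y)) (cong (E (t xor s) x y *_) (support z y)))))) ⟩
    ∑[ z < N ] (E (t xor s) x y * A z y)
      ≡⟨ *-distribˡ-sum (E (t xor s) x y) (λ z → A z y) ⟨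
    E (t xor s) x y * ∑[ z < N ] A z y
      ≡⟨ cong (E (t xor s) x y *_) (columns y) ⟩
    E (t xor s) x y * σ ∎
    where
    open ≡-Reasoning
    open Regular reg
    flip-* : ∀ a b c → a * (b * c) ≡ (b * a) * c
    flip-* = solve-∀
    flip-*′ : ∀ a b c → (a * b) * c ≡ b * (a * c)
    flip-*′ = solve-∀

  Regular-*-E : ∀ t {s σ A} → Regular s σ A → ∀ x y → (A *ᴹ E t) x y ≡ E (t xor s) x y * σ
  Regular-*-E t {s} {σ} {A} reg x y = begin
    ∑[ z < N ] (A x z * E t z y)
      ≡⟨ ∑-cong N (λ z → trans (cong (_* E t z y) (sym (support x z))) (trans (flip-* (E s x z) (A x z) (E t z y))
           (trans (cong (_* A x z) (E-Eˡ s t x z y))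
           (trans (flip-*′ (E s x z) (E (t xor s) x y) (A x z)) (cong (E (t xor s) x y *_) (support x z)))))) ⟩
    ∑[ z < N ] (E (t xor s) x y * A x z)
      ≡⟨ *-distribˡ-sum (E (t xor s) x y) (λ z → A x z) ⟨
    E (t xor s) x y * ∑[ z < N ] A x z
      ≡⟨ cong (E (t xor s) x y *_) (rows x) ⟩
    E (t xor s) x y * σ ∎
    where
    open ≡-Reasoning
    open Regular reg
    flip-* : ∀ a b c → (a * b) * c ≡ (a * c) * b
    flip-* = solve-∀
    flip-*′ : ∀ a b c → (a * b) * c ≡ b * (a * c)
    flip-*′ = solve-∀

  E-Compatible : ∀ t {s σ A} → Regular s σ A → Compatible (E t) A
  E-Compatible t {s} {σ} reg = compatible
    (inSpan (λ ℓ → indicator (crosses ℓ Bool.≟ (t xor s)) * σ) (E-*-Regular t reg))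
    λ x y → trans (E-*-Regular t reg x y) (sym (Regular-*-E t reg x y))

  mat-support : ∀ ℓ x y → E (crosses ℓ) x y * mat ℓ x y ≡ mat ℓ x y
  mat-support ℓ x y with label x y ≟ᴸ ℓ
  ... | yes refl = cong (_* 1ℤ) (indicator-true (crosses (label x y) Bool.≟ crosses (label x y)) refl)
  ... | no _     = ℤ.*-zeroʳ (E (crosses ℓ) x y)

  rot-Regular : ∀ i → Regular false 1ℤ (mat (rot i))
  rot-Regular i = record
    { support = mat-support (rot i)
    ; rows    = λ x → ∑-unique-1 (λ z → label x z ≟ᴸ rot i) (T i x) (label-rot i x) (λ z → label-rot⇒ i x z)
    ; columns = λ y → ∑-unique-1 (λ z → label z y ≟ᴸ rot i) (T (⊖ i) y) (label-rotʳ i y) (λ z → label-rotʳ⇒ i z y)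
    }

  E-rows : ∀ s x → ∑[ z < N ] E s x z ≡ ∑[ z < n ℕ.* v ] 1ℤ
  E-rows s x = begin
    ∑[ z < N ] E s x z
      ≡⟨ ∑-cong N (λ z → cong (λ c → indicator (c Bool.≟ s)) (crosses-label x z)) ⟩
    ∑[ z < N ] h (half′ z)
      ≡⟨ ∑-↑ (n ℕ.* v) (h ∘ half′) ⟩
    ∑[ z < n ℕ.* v ] h (half′ (z ↑ˡ (n ℕ.* v))) + ∑[ z < n ℕ.* v ] h (half′ ((n ℕ.* v) ↑ʳ z))
      ≡⟨ cong₂ _+_ (∑-cong (n ℕ.* v) λ z → cong (h ∘ half ∘ locate {n} {v}) (Fin.splitAt-↑ˡ (n ℕ.* v) z (n ℕ.* v)))
                   (∑-cong (n ℕ.* v) λ z → cong (h ∘ half ∘ locate {n} {v}) (Fin.splitAt-↑ʳ (n ℕ.* v) (n ℕ.* v) z)) ⟩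
    ∑[ z < n ℕ.* v ] h false + ∑[ z < n ℕ.* v ] h true
      ≡⟨ ∑-distrib-+ {n ℕ.* v} (λ _ → h false) (λ _ → h true) ⟨
    ∑[ z < n ℕ.* v ] (h false + h true)
      -- Exactly one of the two halves has crossing type `s` relative to `x`.
      ≡⟨ ∑-cong (n ℕ.* v) (λ _ → total (half′ x) s) ⟩
    ∑[ z < n ℕ.* v ] 1ℤ ∎
    where
    open ≡-Reasoning
    h : Bool → ℤ
    h b = indicator ((half′ x xor b) Bool.≟ s)
    total : ∀ a s → indicator ((a xor false) Bool.≟ s) + indicator ((a xor true) Bool.≟ s) ≡ 1ℤ
    total false false = refl
    total false true  = refl
    total true  false = refl
    total true  true  = refl

  E-Regular : ∀ s → Regular s (∑[ z < n ℕ.* v ] 1ℤ) (E s)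
  E-Regular s = record
    { support = λ x y → indicator-idem (crosses (label x y) Bool.≟ s)
    ; rows    = E-rows s
    ; columns = λ y → trans (∑-cong N λ z → E-swap s y z) (E-rows s y)
    }

  mat-two-shiftˡ : ∀ i x y → mat (two i) x y ≡ mat (two 0̄) (T (⊖ i) x) y
  mat-two-shiftˡ i x y = trans
    (indicator-⇔ (λ eq → trans (cong (shift (⊖ i)) eq) (shift-⊖-two i)) (shift-⊖-two⇒ i (label x y))
                 (label x y ≟ᴸ two i) (shift (⊖ i) (label x y) ≟ᴸ two 0̄))
    (cong (λ ℓ → indicator (ℓ ≟ᴸ two 0̄)) (sym (label-Tˡ (⊖ i) x y)))

  mat-two-shiftʳ : ∀ i x y → mat (two i) x y ≡ mat (two 0̄) x (T i y)
  mat-two-shiftʳ i x y = trans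
    (indicator-⇔ (λ eq → trans (cong (shift (⊖ i)) eq) (shift-⊖-two i)) (shift-⊖-two⇒ i (label x y))
                 (label x y ≟ᴸ two i) (shift (⊖ i) (label x y) ≟ᴸ two 0̄))
    (cong (λ ℓ → indicator (ℓ ≟ᴸ two 0̄)) (sym (label-Tʳ i x y)))

  mat-swap : ∀ ℓ x y → mat ℓ y x ≡ mat (reverse ℓ) x y
  mat-swap ℓ x y = indicator-⇔
    (λ eq → trans (trans (sym (reverse-involutive (label x y))) (cong reverse (sym (label-swap x y)))) (cong reverse eq))
    (λ eq → trans (label-swap x y) (trans (cong reverse eq) (reverse-involutive ℓ)))
    (label y x ≟ᴸ ℓ) (label x y ≟ᴸ reverse ℓ)

  mat-two-0̄-swap : ∀ x y → mat (two 0̄) y x ≡ mat (two 0̄) x y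
  mat-two-0̄-swap x y = trans (mat-swap (two 0̄) x y) (cong (λ t → mat (two t) x y) ⊖0̄≡0̄)

  mat-one : mat one ≋ E false -ᴹ ∑ᴹ (mat ∘ rot)
  mat-one x y with label x y
  ... | rot i = cong (1ℤ -_) (sym (∑-unique-1 (λ j → rot i ≟ᴸ rot j) i refl (λ { j refl → refl })))
  ... | one   = cong (1ℤ -_) (sym (∑-zero {n} (λ _ → 0ℤ) λ _ → refl))
  ... | two _ = cong (0ℤ -_) (sym (∑-zero {n} (λ _ → 0ℤ) λ _ → refl))
  ... | three = cong (0ℤ -_) (sym (∑-zero {n} (λ _ → 0ℤ) λ _ → refl))

  mat-three : mat three ≋ E true -ᴹ ∑ᴹ (mat ∘ two)
  mat-three x y with label x y
  ... | rot _ = cong (0ℤ -_) (sym (∑-zero {n} (λ _ → 0ℤ) λ _ → refl))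
  ... | one   = cong (0ℤ -_) (sym (∑-zero {n} (λ _ → 0ℤ) λ _ → refl))
  ... | two i = cong (1ℤ -_) (sym (∑-unique-1 (λ j → two i ≟ᴸ two j) i refl (λ { j refl → refl })))
  ... | three = cong (1ℤ -_) (sym (∑-zero {n} (λ _ → 0ℤ) λ _ → refl))

  -- All products from the square of A₂ 0̄

  module Closure (k : ℤ) (c : Label n → ℤ) (c-0̄ : c (rot 0̄) ≡ k)
    (square : ∀ x y → (mat (two 0̄) *ᴹ mat (two 0̄)) x y ≡ c (label x y)) where

    label-refl : ∀ x → label x x ≡ rot 0̄
    label-refl x = trans (cong (label x) (sym T-0̄)) (label-rot 0̄ x)
      where
      rotate-0̄ : ∀ z → rotate 0̄ z ≡ z
      rotate-0̄ (inj₁ (p , a)) = cong (λ t → inj₁ (t , a)) (⊕-identityʳ p)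
      rotate-0̄ (inj₂ (p , a)) = cong (λ t → inj₂ (t , a)) (⊕-identityʳ p)
      T-0̄ : T 0̄ x ≡ x
      T-0̄ = trans (cong encode (rotate-0̄ (decode x))) (encode-decode {n} {v} x)

    -- A symmetric matrix with entries 0 and 1 has its row sums on the diagonal of its square.
    two-0̄-rows : ∀ x → ∑[ z < N ] mat (two 0̄) x z ≡ k
    two-0̄-rows x = begin
      ∑[ z < N ] mat (two 0̄) x z
        ≡⟨ ∑-cong N (λ z → trans (sym (indicator-idem (label x z ≟ᴸ two 0̄)))
                                 (cong (mat (two 0̄) x z *_) (mat-two-0̄-swap z x))) ⟩
      ∑[ z < N ] (mat (two 0̄) x z * mat (two 0̄) z x) ≡⟨ square x x ⟩
      c (label x x)                              ≡⟨ cong c (label-refl x) ⟩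
      c (rot 0̄)                                  ≡⟨ c-0̄ ⟩
      k                                              ∎
      where
      open ≡-Reasoning

    two-Regular : ∀ i → Regular true k (mat (two i))
    two-Regular i = record
      { support = mat-support (two i)
      ; rows    = λ x → trans (∑-cong N λ z → mat-two-shiftˡ i x z) (two-0̄-rows (T (⊖ i) x))
      ; columns = λ y → trans (∑-cong N λ z → trans (mat-two-shiftʳ i z y) (mat-two-0̄-swap (T i y) z))
                              (two-0̄-rows (T i y))
      }

    two-*-two : ∀ i j x y → (mat (two i) *ᴹ mat (two j)) x y ≡ c (shift (⊖ i) (shift (⊖ j) (label x y)))
    two-*-two i j x y = begin
      ∑[ z < N ] (mat (two i) x z * mat (two j) z y)
        ≡⟨ ∑-cong N (λ z → cong₂ _*_ (mat-two-shiftˡ i x z) (mat-two-shiftʳ j z y)) ⟩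
      (mat (two 0̄) *ᴹ mat (two 0̄)) (T (⊖ i) x) (T j y) ≡⟨ square (T (⊖ i) x) (T j y) ⟩
      c (label (T (⊖ i) x) (T j y))
        ≡⟨ cong c (trans (label-Tˡ (⊖ i) x (T j y)) (cong (shift (⊖ i)) (label-Tʳ j x y))) ⟩
      c (shift (⊖ i) (shift (⊖ j) (label x y))) ∎
      where open ≡-Reasoning

    two-Compatible : ∀ i j → Compatible (mat (two i)) (mat (two j))
    two-Compatible i j = compatible
      (inSpan (λ ℓ → c (shift (⊖ i) (shift (⊖ j) ℓ))) (two-*-two i j))
      λ x y → trans (two-*-two i j x y)
        (trans (cong c (shift-comm (⊖ i) (⊖ j) (label x y))) (sym (two-*-two j i x y)))

    -- Row sums are computed only for `E s`, `mat (rot i)` and `mat (two i)`; `mat one` and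
    -- `mat three` are always expanded into these.
    one-Compatible : ∀ {s σ A} → InSpan A → Regular s σ A → Compatible (mat one) A
    one-Compatible span reg = Compatible-congˡ mat-one
      (Compatible-minus (E-Compatible false reg) (Compatible-∑ λ i → rot-Compatible i span))

    E-InSpan : ∀ s → InSpan (E s)
    E-InSpan s = inSpan (λ ℓ → indicator (crosses ℓ Bool.≟ s)) λ _ _ → refl

    E-mat-Compatible : ∀ s ℓ → Compatible (E s) (mat ℓ)
    E-mat-Compatible s (rot i) = E-Compatible s (rot-Regular i)
    E-mat-Compatible s one     = Compatible-sym (one-Compatible (E-InSpan s) (E-Regular s))
    E-mat-Compatible s (two i) = E-Compatible s (two-Regular i)
    E-mat-Compatible s three   = Compatible-sym (Compatible-congˡ mat-three
      (Compatible-minus (E-Compatible true (E-Regular s)) (Compatible-∑ λ i → Compatible-sym (E-Compatible s (two-Regular i)))))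

    two-mat-Compatible : ∀ i ℓ → Compatible (mat (two i)) (mat ℓ)
    two-mat-Compatible i (rot j) = Compatible-sym (rot-Compatible j (mat-InSpan (two i)))
    two-mat-Compatible i one     = Compatible-sym (one-Compatible (mat-InSpan (two i)) (two-Regular i))
    two-mat-Compatible i (two j) = two-Compatible i j
    two-mat-Compatible i three   = Compatible-sym (Compatible-congˡ mat-three
      (Compatible-minus (E-Compatible true (two-Regular i)) (Compatible-∑ λ j → two-Compatible j i)))

    mat-Compatible : ∀ ℓ ℓ′ → Compatible (mat ℓ) (mat ℓ′)
    mat-Compatible (rot i) ℓ′ = rot-Compatible i (mat-InSpan ℓ′)
    mat-Compatible one     ℓ′ = Compatible-congˡ mat-one
      (Compatible-minus (E-mat-Compatible false ℓ′) (Compatible-∑ λ i → rot-Compatible i (mat-InSpan ℓ′)))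
    mat-Compatible (two i) ℓ′ = two-mat-Compatible i ℓ′
    mat-Compatible three   ℓ′ = Compatible-congˡ mat-three
      (Compatible-minus (E-mat-Compatible true ℓ′) (Compatible-∑ λ i → two-mat-Compatible i ℓ′))

-- The square of A₂ 0̄

∑-1 : ∀ n → ∑[ i < n ] 1ℤ ≡ ℤᵇ.+ n
∑-1 zero    = refl
∑-1 (suc n) = cong (1ℤ +_) (∑-1 n)

present : Maybe S → ℤ
present x = indicator (T? (is-just x))

matches : Fin n → Maybe (Fin n) → ℤ
matches g (just i) = indicator (g Fin.≟ i)
matches g nothing  = 0ℤ

-- Stated for `tabulate h` because `allFin` is `tabulate` of the identity, whose tail tabulates
-- `suc`; the induction has to vary `h`.
∑-present : (f : S → Maybe (Fin n)) (h : Fin m → S) →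
  ∑[ i < m ] present (f (h i)) ≡ ℤᵇ.+ length (filter (λ x → T? (is-just (f x))) (tabulate h))
∑-present {m = zero}  f h = refl
∑-present {m = suc m} f h with f (h zero)
... | just _  = cong (1ℤ +_) (∑-present f (h ∘ suc))
... | nothing = trans (ℤ.+-identityˡ _) (∑-present f (h ∘ suc))

∑-matches : (g : Fin n) (f : S → Maybe (Fin n)) (h : Fin m → S) →
  ∑[ i < m ] matches g (f (h i)) ≡ ℤᵇ.+ multiplicity g (mapMaybe f (tabulate h))
∑-matches {m = zero}  g f h = refl
∑-matches {m = suc m} g f h with f (h zero)
... | nothing = trans (ℤ.+-identityˡ _) (∑-matches g f (h ∘ suc))
... | just i with g Fin.≟ i
...   | yes _ = cong (1ℤ +_) (∑-matches g f (h ∘ suc))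
...   | no _  = trans (ℤ.+-identityˡ _) (∑-matches g f (h ∘ suc))

module Gram {n v k lam : ℕ} .{{_ : NonZero n}} (2≤n : 2 ℕ.≤ n) (W : EntryMatrix n v) (bgw : IsBGW n v k lam W) where

  open Coloring W
  open Products W
  open IsBGW bgw

  kℤ μ : ℤ
  kℤ = ℤᵇ.+ k
  μ = ℤᵇ.+ (lam / n)

  -- Common neighbours in the bipartite graph of A₂ 0̄: `k` for a point with itself, none for
  -- distinct points of one class, `μ` for different classes of one half, none across the halves.
  squareCoeff : Label n → ℤ
  squareCoeff (rot i) = indicator (i Fin.≟ 0̄) * kℤ
  squareCoeff one     = μ
  squareCoeff (two _) = 0ℤ
  squareCoeff three   = 0ℤ

  ∑-row-present : ∀ a → ∑[ c < v ] present (W a c) ≡ kℤ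
  ∑-row-present a = trans (∑-present (W a) (λ c → c)) (cong ℤᵇ.+_ (row-weight a))

  ∑-row-differences : ∀ a b g → ∑[ c < v ] matches g (zipWith _⊖_ (W a c) (W b c)) ≡
                      ℤᵇ.+ multiplicity g (differences W a b)
  ∑-row-differences a b g = ∑-matches g (λ c → zipWith _⊖_ (W a c) (W b c)) (λ c → c)

  half-label : Fin n × Fin v → Fin n × Fin v → Label n
  half-label u w = pointLabel (inj₁ u) (inj₂ w)

  link : Fin n × Fin v → Fin n × Fin v → ℤ
  link u w = indicator (half-label u w ≟ᴸ two 0̄)

  linkEntry : Fin n → Fin n → Maybe (Fin n) → ℤ
  linkEntry p r w = indicator (maybe′ (λ w → two (w ⊖ (r ⊖ p))) three w ≟ᴸ two 0̄)

  two≡two0̄⇒ : ∀ w r p → two (w ⊖ (r ⊖ p)) ≡ two 0̄ → r ≡ w ⊕ p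
  two≡two0̄⇒ w r p eq = i⊖j≡k⇒i≡k⊕j r p w (sym (i⊖j≡0̄⇒i≡j w (r ⊖ p) (two-injective eq)))

  two≡two0̄ : ∀ w p → two (w ⊖ ((w ⊕ p) ⊖ p)) ≡ two 0̄
  two≡two0̄ w p = cong two (trans (cong (λ t → w ⊖ t) ([i⊕j]⊖j≡i p w)) (⊕-inverseʳ w))

  -- With entry `w`, a point of coordinate `p` has one neighbour in the column class, at r = w ⊕ p.
  -- Two points share it exactly when w ⊕ p = w′ ⊕ q, that is q ⊖ p = w ⊖ w′. This turns counting
  -- common neighbours into counting differences.
  ∑-link-entries : ∀ p q (w w′ : Maybe (Fin n)) →
    ∑[ r < n ] (linkEntry p r w * linkEntry q r w′) ≡ matches (q ⊖ p) (zipWith _⊖_ w w′)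
  ∑-link-entries p q nothing w′ = ∑-zero {n} _ λ _ → refl
  ∑-link-entries p q (just w) nothing = ∑-zero {n} _ λ r → ℤ.*-zeroʳ (linkEntry p r (just w))
  ∑-link-entries p q (just w) (just w′) = trans
    (∑-unique (λ r → two (w ⊖ (r ⊖ p)) ≟ᴸ two 0̄) (w ⊕ p) (two≡two0̄ w p) (λ r → two≡two0̄⇒ w r p)
              (λ r → linkEntry q r (just w′)))
    (indicator-⇔ to from (two (w′ ⊖ ((w ⊕ p) ⊖ q)) ≟ᴸ two 0̄) ((q ⊖ p) Fin.≟ (w ⊖ w′)))
    where
    open ≡-Reasoning
    to : two (w′ ⊖ ((w ⊕ p) ⊖ q)) ≡ two 0̄ → q ⊖ p ≡ w ⊖ w′
    to eq = i≡k⊕j⇒i⊖j≡k q p (w ⊖ w′) (sym (begin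
      (w ⊖ w′) ⊕ p ≡⟨ ⊕-⊖-swap w p w′ ⟨
      (w ⊕ p) ⊖ w′ ≡⟨ i≡k⊕j⇒i⊖j≡k (w ⊕ p) w′ q (trans (two≡two0̄⇒ w′ (w ⊕ p) q eq) (⊕-comm w′ q)) ⟩
      q            ∎))
    from : q ⊖ p ≡ w ⊖ w′ → two (w′ ⊖ ((w ⊕ p) ⊖ q)) ≡ two 0̄
    from eq = trans (cong (λ t → two (w′ ⊖ (t ⊖ q))) (begin
      w ⊕ p               ≡⟨ cong (_⊕ p) ([i⊖j]⊕j≡i w′ w) ⟨
      ((w ⊖ w′) ⊕ w′) ⊕ p ≡⟨ cong (λ t → (t ⊕ w′) ⊕ p) eq ⟨
      ((q ⊖ p) ⊕ w′) ⊕ p  ≡⟨ cong (_⊕ p) (⊕-comm (q ⊖ p) w′) ⟩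
      (w′ ⊕ (q ⊖ p)) ⊕ p  ≡⟨ ⊕-assoc w′ (q ⊖ p) p ⟩
      w′ ⊕ ((q ⊖ p) ⊕ p)  ≡⟨ cong (w′ ⊕_) ([i⊖j]⊕j≡i p q) ⟩
      w′ ⊕ q              ∎)) (two≡two0̄ w′ q)

  matches-self : ∀ g (w : Maybe (Fin n)) → matches g (zipWith _⊖_ w w) ≡ indicator (g Fin.≟ 0̄) * present w
  matches-self g nothing  = sym (ℤ.*-zeroʳ (indicator (g Fin.≟ 0̄)))
  matches-self g (just w) = trans (cong (λ t → indicator (g Fin.≟ t)) (⊕-inverseʳ w)) (sym (ℤ.*-identityʳ _))

  -- For a = b every difference is `0̄`, which leaves the weight of the row; for a ≠ b this is the
  -- balance condition.
  ∑-row-matches : ∀ {a b} (a≟b : Dec (a ≡ b)) g →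
    ∑[ c < v ] matches g (zipWith _⊖_ (W a c) (W b c)) ≡ squareCoeff (sameLabel a≟b g)
  ∑-row-matches {a} (yes refl) g = begin
    ∑[ c < v ] matches g (zipWith _⊖_ (W a c) (W a c))  ≡⟨ ∑-cong v (λ c → matches-self g (W a c)) ⟩
    ∑[ c < v ] (indicator (g Fin.≟ 0̄) * present (W a c))
      ≡⟨ *-distribˡ-sum (indicator (g Fin.≟ 0̄)) (λ c → present (W a c)) ⟨
    indicator (g Fin.≟ 0̄) * ∑[ c < v ] present (W a c)
      ≡⟨ cong (indicator (g Fin.≟ 0̄) *_) (∑-row-present a) ⟩
    indicator (g Fin.≟ 0̄) * kℤ                          ∎
    where open ≡-Reasoning
  ∑-row-matches {a} {b} (no a≢b) g = trans (∑-row-differences a b g) (cong ℤᵇ.+_ (balanced a b a≢b g))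

  gram : ∀ u w → ∑[ z < n ℕ.* v ] (link u (rq z) * link w (rq z)) ≡ squareCoeff (pointLabel (inj₁ u) (inj₁ w))
  gram u@(p , a) w@(q , b) = begin
    ∑[ z < n ℕ.* v ] (link u (rq z) * link w (rq z))
      ≡⟨ ∑-combine n (λ z → link u (rq z) * link w (rq z)) ⟩
    ∑[ r < n ] ∑[ c < v ] (link u (rq (combine r c)) * link w (rq (combine r c)))
      ≡⟨ (∑-cong n λ r → ∑-cong v λ c → cong (λ z → link u z * link w z) (Fin.remQuot-combine {n} {v} r c)) ⟩
    ∑[ r < n ] ∑[ c < v ] (linkEntry p r (W a c) * linkEntry q r (W b c))
      ≡⟨ ∑-comm {n} {v} (λ r c → linkEntry p r (W a c) * linkEntry q r (W b c)) ⟩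
    ∑[ c < v ] ∑[ r < n ] (linkEntry p r (W a c) * linkEntry q r (W b c))
      ≡⟨ ∑-cong v (λ c → ∑-link-entries p q (W a c) (W b c)) ⟩
    ∑[ c < v ] matches (q ⊖ p) (zipWith _⊖_ (W a c) (W b c))
      ≡⟨ ∑-row-matches (a Fin.≟ b) (q ⊖ p) ⟩
    squareCoeff (sameLabel (a Fin.≟ b) (q ⊖ p)) ∎
    where open ≡-Reasoning

  -- The incidence matrix, its translations and its dual Gram matrix

  M : Matrix (n ℕ.* v) (n ℕ.* v)
  M x y = link (rq x) (rq y)

  turn : Fin n → Fin (n ℕ.* v) → Fin (n ℕ.* v)
  turn i x = combine (proj₁ (rq x) ⊕ i) (proj₂ (rq x))

  rq-turn : ∀ i x → rq (turn i x) ≡ (proj₁ (rq x) ⊕ i , proj₂ (rq x))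
  rq-turn i x = Fin.remQuot-combine {n} {v} (proj₁ (rq x) ⊕ i) (proj₂ (rq x))

  rq-injective : ∀ {x y} → rq x ≡ rq y → x ≡ y
  rq-injective {x} {y} eq = trans (sym (Fin.combine-remQuot {n} v x))
    (trans (cong (uncurry combine) eq) (Fin.combine-remQuot {n} v y))

  turn-turn : ∀ i j → i ⊕ j ≡ 0̄ → ∀ x → turn j (turn i x) ≡ x
  turn-turn i j i⊕j≡0̄ x = rq-injective (begin
    rq (turn j (turn i x))                                     ≡⟨ rq-turn j (turn i x) ⟩
    (proj₁ (rq (turn i x)) ⊕ j , proj₂ (rq (turn i x)))        ≡⟨ cong (λ z → proj₁ z ⊕ j , proj₂ z) (rq-turn i x) ⟩
    ((proj₁ (rq x) ⊕ i) ⊕ j , proj₂ (rq x))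
      ≡⟨ cong (_, proj₂ (rq x)) (trans (⊕-assoc (proj₁ (rq x)) i j)
           (trans (cong (proj₁ (rq x) ⊕_) i⊕j≡0̄) (⊕-identityʳ (proj₁ (rq x))))) ⟩
    rq x                                                       ∎)
    where open ≡-Reasoning

  1̄ : Fin n
  1̄ = 1 mod n

  turn-free : ∀ x → turn 1̄ x ≢ x
  turn-free x eq = 1̄≢0̄ 2≤n (⊕-cancelˡ (proj₁ (rq x)) 1̄ 0̄
    (trans (sym (cong proj₁ (rq-turn 1̄ x))) (trans (cong (proj₁ ∘ rq) eq) (sym (⊕-identityʳ _)))))

  -- An entry depends on the two ℤ_n coordinates only through their difference.
  M-turn : ∀ i x y → M (turn i x) (turn i y) ≡ M x y
  M-turn i x y = trans (cong₂ link (rq-turn i x) (rq-turn i y)) (lemma (rq x) (rq y))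
    where
    lemma : ∀ u w → link (proj₁ u ⊕ i , proj₂ u) (proj₁ w ⊕ i , proj₂ w) ≡ link u w
    lemma (p , a) (q , b) with W a b
    ... | nothing = refl
    ... | just w  = cong (λ t → indicator (two (w ⊖ t) ≟ᴸ two 0̄))
      (trans (i⊖[j⊕k]≡[i⊖j]⊖k (q ⊕ i) p i) (trans (⊖-swap (q ⊕ i) p i) (cong (_⊖ p) ([i⊕j]⊖j≡i i q))))

  -- A neighbour of (r, a) over `b` must have coordinate w ⊕ r, so there is at most one.
  link-orthogonal : ∀ u p q b → p ≢ q → link u (p , b) * link u (q , b) ≡ 0ℤ
  link-orthogonal (r , a) p q b p≢q with W a b
  ... | nothing = refl
  ... | just w  = trans (indicator-*-cong (two (w ⊖ (p ⊖ r)) ≟ᴸ two 0̄) {_} {0ℤ} λ eq →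
      indicator-false (two (w ⊖ (q ⊖ r)) ≟ᴸ two 0̄) λ eq′ →
        p≢q (trans (two≡two0̄⇒ w p r eq) (sym (two≡two0̄⇒ w q r eq′))))
    (ℤ.*-zeroʳ (indicator (two (w ⊖ (p ⊖ r)) ≟ᴸ two 0̄)))

  class : Fin (n ℕ.* v) → Fin v
  class = proj₂ ∘ rq

  M-orthogonal : ∀ x {y z} → y ≢ z → class y ≡ class z → M x y * M x z ≡ 0ℤ
  M-orthogonal x {y} {z} y≢z eq = trans
    (cong (λ t → link (rq x) (rq y) * link (rq x) (proj₁ (rq z) , t)) (sym eq))
    (link-orthogonal (rq x) (proj₁ (rq y)) (proj₁ (rq z)) (class y)
      λ eq′ → y≢z (rq-injective (cong₂ _,_ eq′ eq)))

  squareCoeff-rot-0̄ : squareCoeff (rot 0̄) ≡ kℤ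
  squareCoeff-rot-0̄ = trans (cong (_* kℤ) (indicator-true (0̄ Fin.≟ 0̄) refl)) (ℤ.*-identityˡ kℤ)

  gram-diagonal : ∀ x → (M *ᴹ M ᵀ) x x ≡ kℤ
  gram-diagonal x = trans (gram (rq x) (rq x))
    (trans (cong squareCoeff (trans (sameLabel-refl (class x) (proj₁ (rq x) ⊖ proj₁ (rq x)))
                                    (cong rot (⊕-inverseʳ (proj₁ (rq x)))))) squareCoeff-rot-0̄)

  gram-class : ∀ {x y} → x ≢ y → class x ≡ class y → (M *ᴹ M ᵀ) x y ≡ 0ℤ
  gram-class {x} {y} x≢y eq = trans (gram (rq x) (rq y)) (lemma (class x Fin.≟ class y))
    where
    lemma : (d : Dec (class x ≡ class y)) → squareCoeff (sameLabel d (proj₁ (rq y) ⊖ proj₁ (rq x))) ≡ 0ℤ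
    lemma (no neq) = contradiction eq neq
    lemma (yes _)  = cong (_* kℤ) (indicator-false ((proj₁ (rq y) ⊖ proj₁ (rq x)) Fin.≟ 0̄) λ eq′ →
      x≢y (rq-injective (cong₂ _,_ (sym (i⊖j≡0̄⇒i≡j (proj₁ (rq y)) (proj₁ (rq x)) eq′)) eq)))

  gram-other : ∀ {x y} → class x ≢ class y → (M *ᴹ M ᵀ) x y ≡ μ
  gram-other {x} {y} neq = trans (gram (rq x) (rq y)) (lemma (class x Fin.≟ class y))
    where
    lemma : (d : Dec (class x ≡ class y)) → squareCoeff (sameLabel d (proj₁ (rq y) ⊖ proj₁ (rq x))) ≡ μ
    lemma (no _)   = refl
    lemma (yes eq) = contradiction eq neq

  module D = Duality class Fin._≟_ M kℤ μ (turn 1̄) (turn (⊖ 1̄))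
    (turn-turn (⊖ 1̄) 1̄ (trans (⊕-comm (⊖ 1̄) 1̄) (⊕-inverseʳ 1̄))) (turn-turn 1̄ (⊖ 1̄) (⊕-inverseʳ 1̄))
    (λ x → cong proj₂ (rq-turn 1̄ x)) turn-free (M-turn 1̄)
    (λ x y → indicator-idem (half-label (rq x) (rq y) ≟ᴸ two 0̄)) M-orthogonal
    gram-diagonal gram-class gram-other

  -- Labels inside the second half are given by the same formula as inside the first, so the value
  -- found by `gram` carries over unchanged.
  cogram : ∀ x y → ∑[ z < n ℕ.* v ] (M z x * M z y) ≡ squareCoeff (pointLabel (inj₂ (rq x)) (inj₂ (rq y)))
  cogram x y = trans (D.gram-dual x y) (gram (rq x) (rq y))

  pointMat : Point n v → Point n v → ℤ
  pointMat x y = indicator (pointLabel x y ≟ᴸ two 0̄)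

  pointMat-swap : ∀ x y → pointMat y x ≡ pointMat x y
  pointMat-swap x y = subst₂ (λ s t → pointMat s t ≡ pointMat t s) (decode-encode y) (decode-encode x)
    (mat-two-0̄-swap (encode x) (encode y))

  pointMat-half : ∀ x y → half x ≡ half y → pointMat x y ≡ 0ℤ
  pointMat-half x y eq = indicator-false (pointLabel x y ≟ᴸ two 0̄) λ eq′ → contradiction
    (trans (sym (cong crosses eq′)) (trans (crosses-pointLabel x y)
      (trans (cong (_xor half y) eq) (Bool.xor-same (half y))))) λ ()

  squareCoeff-crosses : ∀ ℓ → crosses ℓ ≡ true → squareCoeff ℓ ≡ 0ℤ
  squareCoeff-crosses (two _) _ = refl
  squareCoeff-crosses three   _ = refl

  -- Neighbours lie in the opposite half. One of the two sums therefore vanishes when the endpoints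
  -- share a half, and both vanish otherwise.
  squareAt : (s t : Fin (n ℕ.* v) ⊎ Fin (n ℕ.* v)) →
    ∑[ z < n ℕ.* v ] (pointMat (locate s) (inj₁ (rq z)) * pointMat (inj₁ (rq z)) (locate t)) +
    ∑[ z < n ℕ.* v ] (pointMat (locate s) (inj₂ (rq z)) * pointMat (inj₂ (rq z)) (locate t))
    ≡ squareCoeff (pointLabel (locate s) (locate t))
  squareAt (inj₁ x) (inj₁ y) = trans (cong₂ _+_
    (∑-zero {n ℕ.* v} _ λ z → cong (_* pointMat (inj₁ (rq z)) (inj₁ (rq y))) (pointMat-half (inj₁ (rq x)) (inj₁ (rq z)) refl))
    (trans (∑-cong (n ℕ.* v) λ z → cong (M x z *_) (pointMat-swap (inj₁ (rq y)) (inj₂ (rq z)))) (gram (rq x) (rq y))))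
    (ℤ.+-identityˡ _)
  squareAt (inj₁ x) (inj₂ y) = trans (cong₂ _+_
    (∑-zero {n ℕ.* v} _ λ z → cong (_* pointMat (inj₁ (rq z)) (inj₂ (rq y))) (pointMat-half (inj₁ (rq x)) (inj₁ (rq z)) refl))
    (∑-zero {n ℕ.* v} _ λ z → trans (cong (M x z *_) (pointMat-half (inj₂ (rq z)) (inj₂ (rq y)) refl)) (ℤ.*-zeroʳ (M x z))))
    (sym (squareCoeff-crosses _ (crosses-pointLabel (inj₁ (rq x)) (inj₂ (rq y)))))
  squareAt (inj₂ x) (inj₁ y) = trans (cong₂ _+_
    (∑-zero {n ℕ.* v} _ λ z → trans (cong (pointMat (inj₂ (rq x)) (inj₁ (rq z)) *_)
                                           (pointMat-half (inj₁ (rq z)) (inj₁ (rq y)) refl))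
                               (ℤ.*-zeroʳ (pointMat (inj₂ (rq x)) (inj₁ (rq z)))))
    (∑-zero {n ℕ.* v} _ λ z → cong (_* pointMat (inj₂ (rq z)) (inj₁ (rq y))) (pointMat-half (inj₂ (rq x)) (inj₂ (rq z)) refl)))
    (sym (squareCoeff-crosses _ (crosses-pointLabel (inj₂ (rq x)) (inj₁ (rq y)))))
  squareAt (inj₂ x) (inj₂ y) = trans (cong₂ _+_
    (trans (∑-cong (n ℕ.* v) λ z → cong (_* M z y) (pointMat-swap (inj₁ (rq z)) (inj₂ (rq x)))) (cogram x y))
    (∑-zero {n ℕ.* v} _ λ z → cong (_* pointMat (inj₂ (rq z)) (inj₂ (rq y))) (pointMat-half (inj₂ (rq x)) (inj₂ (rq z)) refl)))
    (ℤ.+-identityʳ _)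

  square : ∀ x y → (mat (two 0̄) *ᴹ mat (two 0̄)) x y ≡ squareCoeff (label x y)
  square x y = begin
    ∑[ z < N ] F (decode z)
      ≡⟨ ∑-↑ (n ℕ.* v) (F ∘ decode {n} {v}) ⟩
    ∑[ z < n ℕ.* v ] F (decode (z ↑ˡ (n ℕ.* v))) + ∑[ z < n ℕ.* v ] F (decode ((n ℕ.* v) ↑ʳ z))
      ≡⟨ cong₂ _+_ (∑-cong (n ℕ.* v) λ z → cong (F ∘ locate {n} {v}) (Fin.splitAt-↑ˡ (n ℕ.* v) z (n ℕ.* v)))
                   (∑-cong (n ℕ.* v) λ z → cong (F ∘ locate {n} {v}) (Fin.splitAt-↑ʳ (n ℕ.* v) (n ℕ.* v) z)) ⟩
    ∑[ z < n ℕ.* v ] F (inj₁ (rq z)) + ∑[ z < n ℕ.* v ] F (inj₂ (rq z))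
      ≡⟨ squareAt (splitAt (n ℕ.* v) x) (splitAt (n ℕ.* v) y) ⟩
    squareCoeff (label x y) ∎
    where
    open ≡-Reasoning
    F : Point n v → ℤ
    F z = pointMat (decode x) z * pointMat z (decode y)

  open Closure kℤ squareCoeff squareCoeff-rot-0̄ square public using (label-refl; mat-Compatible)

  ∃-nonzero : 1 ℕ.≤ k → ∀ a → ∃[ c ] ∃[ w ] W a c ≡ just w
  ∃-nonzero 1≤k a with Fin.any? (λ c → T? (is-just (W a c)))
  ... | yes (c , isJust) with W a c in eq
  ...   | just w = c , w , eq
  ∃-nonzero 1≤k a | no none = contradiction
    (trans (sym (∑-row-present a)) (∑-zero _ λ c → indicator-false (T? (is-just (W a c))) λ p → none (c , p)))
    λ eq → ℕ.<⇒≢ 1≤k (sym (ℤ.+-injective eq))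

  ∃-zero : k ℕ.< v → ∀ a → ∃[ c ] W a c ≡ nothing
  ∃-zero k<v a with Fin.any? (λ c → ¬? (T? (is-just (W a c))))
  ... | yes (c , notJust) with W a c in eq
  ...   | nothing = c , eq
  ...   | just _  = contradiction _ notJust
  ∃-zero k<v a | no none = contradiction
    (trans (sym (∑-row-present a)) (trans (∑-cong v λ c → indicator-true (T? (is-just (W a c)))
       (decidable-stable (T? (is-just (W a c))) λ p → none (c , p))) (∑-1 v)))
    λ eq → ℕ.<⇒≢ k<v (ℤ.+-injective eq)

  -- The nonnegative numbers 1 - `present` sum to v - k = 0 along the row.
  full-row : k ≡ v → ∀ a c → W a c ≢ nothing
  full-row refl a c eq = contradiction
    (trans (sym (cong (λ w → 1ℤ - present w) eq)) (∑≤0⇒≡0 (λ c → 1ℤ - present (W a c)) nonneg (ℤ.≤-reflexive total) c))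
    λ ()
    where
    nonneg : ∀ c → 0ℤ ≤ℤ 1ℤ - present (W a c)
    nonneg c with W a c
    ... | just _  = ℤ.≤-refl
    ... | nothing = ℤᵇ.+≤+ ℕ.z≤n
    total : ∑[ c < v ] (1ℤ - present (W a c)) ≡ 0ℤ
    total = trans (∑-distrib-minus (λ _ → 1ℤ) (λ c → present (W a c)))
      (trans (cong₂ _-_ (∑-1 v) (∑-row-present a)) (ℤ.+-inverseʳ (ℤᵇ.+ v)))

-- The schemes

module Entries {n v : ℕ} .{{_ : NonZero n}} (2≤n : 2 ≤ n) (W : EntryMatrix n v) where

  open Coloring W
  open Products W

  rot-entry : ∀ {a b} (a≟b : Dec (a ≡ b)) (i p q : Fin n) →
    (P n ^ᴹ toℕ i) p q * indicator a≟b ≡ indicator (sameLabel a≟b (q ⊖ p) ≟ᴸ rot i)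
  rot-entry (yes _) i p q = trans (ℤ.*-identityʳ ((P n ^ᴹ toℕ i) p q)) (P-power-entry-toℕ 2≤n i p q)
  rot-entry (no _)  i p q = ℤ.*-zeroʳ ((P n ^ᴹ toℕ i) p q)

  one-entry : ∀ {a b} (a≟b : Dec (a ≡ b)) (d : Fin n) →
    1ℤ * (1ℤ - indicator a≟b) ≡ indicator (sameLabel a≟b d ≟ᴸ one)
  one-entry (yes _) d = refl
  one-entry (no _)  d = refl

  same≢two : ∀ {a b} (a≟b : Dec (a ≡ b)) (d i : Fin n) → 0ℤ ≡ indicator (sameLabel a≟b d ≟ᴸ two i)
  same≢two (yes _) d i = refl
  same≢two (no _)  d i = refl

  same≢three : ∀ {a b} (a≟b : Dec (a ≡ b)) (d : Fin n) → 0ℤ ≡ indicator (sameLabel a≟b d ≟ᴸ three)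
  same≢three (yes _) d = refl
  same≢three (no _)  d = refl

  -- An arbitrary `f` lets one lemma serve both off-diagonal blocks, whose labels use different
  -- formulas.
  cross≢rot : (f : Fin n → Fin n) (w : Maybe (Fin n)) (i : Fin n) →
    0ℤ ≡ indicator (maybe′ (two ∘ f) three w ≟ᴸ rot i)
  cross≢rot f (just _) i = refl
  cross≢rot f nothing  i = refl

  cross≢one : (f : Fin n → Fin n) (w : Maybe (Fin n)) → 0ℤ ≡ indicator (maybe′ (two ∘ f) three w ≟ᴸ one)
  cross≢one f (just _) = refl
  cross≢one f nothing  = refl

  _≟ᴹ_ : (w w′ : Maybe (Fin n)) → Dec (w ≡ w′)
  _≟ᴹ_ = Maybe.≡-dec Fin._≟_

  ∑-P-power : (f : Vector ℤ n) (p q : Fin n) → ∑[ j < n ] ((P n ^ᴹ toℕ j) p q * f j) ≡ f (q ⊖ p)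
  ∑-P-power f p q = trans (∑-cong n λ j → cong (_* f j) (P-power-entry-toℕ 2≤n j p q))
    (∑-unique (λ j → (q ⊖ p) Fin.≟ j) (q ⊖ p) refl (λ _ → sym) f)

  -- Only the summand j = q ⊖ p survives, and its condition w = i ⊕ j is the label equation solved
  -- for `w`.
  two-entryᵘ : (w : Maybe (Fin n)) (i p q : Fin n) →
    ∑[ j < n ] ((P n ^ᴹ toℕ j) p q * indicator (w ≟ᴹ just (i ⊕ j))) ≡
    indicator (maybe′ (λ w → two (w ⊖ (q ⊖ p))) three w ≟ᴸ two i)
  two-entryᵘ w i p q = trans (∑-P-power (λ j → indicator (w ≟ᴹ just (i ⊕ j))) p q) (lemma w)
    where
    lemma : ∀ w → indicator (w ≟ᴹ just (i ⊕ (q ⊖ p))) ≡ indicator (maybe′ (λ w → two (w ⊖ (q ⊖ p))) three w ≟ᴸ two i)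
    lemma nothing  = refl
    lemma (just w) = indicator-⇔
      (λ eq → cong two (i≡k⊕j⇒i⊖j≡k w (q ⊖ p) i (Maybe.just-injective eq)))
      (λ eq → cong just (i⊖j≡k⇒i≡k⊕j w (q ⊖ p) i (two-injective eq)))
      (just w ≟ᴹ just (i ⊕ (q ⊖ p))) (two (w ⊖ (q ⊖ p)) ≟ᴸ two i)

  two-entryˡ : (w : Maybe (Fin n)) (i p q : Fin n) →
    ∑[ j < n ] ((P n ^ᴹ toℕ j) p q * indicator (w ≟ᴹ just ((⊖ i) ⊖ j))) ≡
    indicator (maybe′ (λ w → two ((p ⊖ q) ⊖ w)) three w ≟ᴸ two i)
  two-entryˡ w i p q = trans (∑-P-power (λ j → indicator (w ≟ᴹ just ((⊖ i) ⊖ j))) p q) (lemma w)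
    where
    open ≡-Reasoning
    flip-sides : (⊖ i) ⊖ (q ⊖ p) ≡ (p ⊖ q) ⊖ i
    flip-sides = trans (⊕-comm (⊖ i) (⊖ (q ⊖ p))) (cong (_⊖ i) (⊖-anti-homo-⊖ q p))
    swap-sides : ∀ w i → w ≡ (p ⊖ q) ⊖ i → (p ⊖ q) ⊖ w ≡ i
    swap-sides w i eq = i≡k⊕j⇒i⊖j≡k (p ⊖ q) w i (begin
      p ⊖ q               ≡⟨ [i⊖j]⊕j≡i i (p ⊖ q) ⟨
      ((p ⊖ q) ⊖ i) ⊕ i   ≡⟨ ⊕-comm ((p ⊖ q) ⊖ i) i ⟩
      i ⊕ ((p ⊖ q) ⊖ i)   ≡⟨ cong (i ⊕_) eq ⟨
      i ⊕ w               ∎)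
    lemma : ∀ w → indicator (w ≟ᴹ just ((⊖ i) ⊖ (q ⊖ p))) ≡ indicator (maybe′ (λ w → two ((p ⊖ q) ⊖ w)) three w ≟ᴸ two i)
    lemma nothing  = refl
    lemma (just w) = indicator-⇔
      (λ eq → cong two (swap-sides w i (trans (Maybe.just-injective eq) flip-sides)))
      (λ eq → cong just (trans (sym (swap-sides i w (sym (two-injective eq)))) (sym flip-sides)))
      (just w ≟ᴹ just ((⊖ i) ⊖ (q ⊖ p))) (two ((p ⊖ q) ⊖ w) ≟ᴸ two i)

  three-entry : (f : Fin n → Fin n) (w : Maybe (Fin n)) →
    1ℤ * (1ℤ - ∑[ j < n ] indicator (w ≟ᴹ just j)) ≡ indicator (maybe′ (two ∘ f) three w ≟ᴸ three)
  three-entry f nothing  = cong (λ t → 1ℤ * (1ℤ - t)) (∑-zero {n} _ λ _ → refl)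
  three-entry f (just w) = cong (λ t → 1ℤ * (1ℤ - t))
    (∑-unique-1 (λ j → just w ≟ᴹ just j) w refl λ { _ refl → refl })

  A₀-mat : ∀ i → A₀ W i ≋ mat (rot i)
  A₀-mat i x y with splitAt (n ℕ.* v) x | splitAt (n ℕ.* v) y
  ... | inj₁ x′ | inj₁ y′ = rot-entry (proj₂ (rq x′) Fin.≟ proj₂ (rq y′)) i (proj₁ (rq x′)) (proj₁ (rq y′))
  ... | inj₁ x′ | inj₂ y′ = cross≢rot (λ w → w ⊖ (proj₁ (rq y′) ⊖ proj₁ (rq x′))) (W (proj₂ (rq x′)) (proj₂ (rq y′))) i
  ... | inj₂ x′ | inj₁ y′ = cross≢rot (λ w → (proj₁ (rq x′) ⊖ proj₁ (rq y′)) ⊖ w) (W (proj₂ (rq y′)) (proj₂ (rq x′))) i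
  ... | inj₂ x′ | inj₂ y′ = rot-entry (proj₂ (rq x′) Fin.≟ proj₂ (rq y′)) i (proj₁ (rq x′)) (proj₁ (rq y′))

  A₁-mat : A₁ W ≋ mat one
  A₁-mat x y with splitAt (n ℕ.* v) x | splitAt (n ℕ.* v) y
  ... | inj₁ x′ | inj₁ y′ = one-entry (proj₂ (rq x′) Fin.≟ proj₂ (rq y′)) (proj₁ (rq y′) ⊖ proj₁ (rq x′))
  ... | inj₁ x′ | inj₂ y′ = cross≢one (λ w → w ⊖ (proj₁ (rq y′) ⊖ proj₁ (rq x′))) (W (proj₂ (rq x′)) (proj₂ (rq y′)))
  ... | inj₂ x′ | inj₁ y′ = cross≢one (λ w → (proj₁ (rq x′) ⊖ proj₁ (rq y′)) ⊖ w) (W (proj₂ (rq y′)) (proj₂ (rq x′)))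
  ... | inj₂ x′ | inj₂ y′ = one-entry (proj₂ (rq x′) Fin.≟ proj₂ (rq y′)) (proj₁ (rq y′) ⊖ proj₁ (rq x′))

  A₂-mat : ∀ i → A₂ W i ≋ mat (two i)
  A₂-mat i x y with splitAt (n ℕ.* v) x | splitAt (n ℕ.* v) y
  ... | inj₁ x′ | inj₁ y′ = same≢two (proj₂ (rq x′) Fin.≟ proj₂ (rq y′)) (proj₁ (rq y′) ⊖ proj₁ (rq x′)) i
  ... | inj₁ x′ | inj₂ y′ = two-entryᵘ (W (proj₂ (rq x′)) (proj₂ (rq y′))) i (proj₁ (rq x′)) (proj₁ (rq y′))
  ... | inj₂ x′ | inj₁ y′ = two-entryˡ (W (proj₂ (rq y′)) (proj₂ (rq x′))) i (proj₁ (rq x′)) (proj₁ (rq y′))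
  ... | inj₂ x′ | inj₂ y′ = same≢two (proj₂ (rq x′) Fin.≟ proj₂ (rq y′)) (proj₁ (rq y′) ⊖ proj₁ (rq x′)) i

  A₃-mat : A₃ W ≋ mat three
  A₃-mat x y with splitAt (n ℕ.* v) x | splitAt (n ℕ.* v) y
  ... | inj₁ x′ | inj₁ y′ = same≢three (proj₂ (rq x′) Fin.≟ proj₂ (rq y′)) (proj₁ (rq y′) ⊖ proj₁ (rq x′))
  ... | inj₁ x′ | inj₂ y′ = three-entry (λ w → w ⊖ (proj₁ (rq y′) ⊖ proj₁ (rq x′))) (W (proj₂ (rq x′)) (proj₂ (rq y′)))
  ... | inj₂ x′ | inj₁ y′ = three-entry (λ w → (proj₁ (rq x′) ⊖ proj₁ (rq y′)) ⊖ w) (W (proj₂ (rq y′)) (proj₂ (rq x′)))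
  ... | inj₂ x′ | inj₂ y′ = same≢three (proj₂ (rq x′) Fin.≟ proj₂ (rq y′)) (proj₁ (rq y′) ⊖ proj₁ (rq x′))

-- Triviality of inversion in ℤ_n

n≡2⇒⊖i≡i : ∀ {n} .{{_ : NonZero n}} → n ≡ 2 → ∀ (i : Fin n) → ⊖ i ≡ i
n≡2⇒⊖i≡i refl zero       = refl
n≡2⇒⊖i≡i refl (suc zero) = refl

⊖1̄≡1̄⇒n≡2 : ∀ {n} .{{_ : NonZero n}} → 2 ≤ n → ⊖ (1 mod n) ≡ 1 mod n → n ≡ 2
⊖1̄≡1̄⇒n≡2 {n} 2≤n eq with ℕ.m≤n⇒m<n∨m≡n 2≤n
... | inj₂ 2≡n = sym 2≡n
-- For 2 < n the number 2 is its own remainder, so 1̄ ⊕ 1̄ = 0̄ would read 2 = 0.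
... | inj₁ 2<n = contradiction (begin
    2                         ≡⟨ m<n⇒m%n≡m 2<n ⟨
    2 % n                     ≡⟨ toℕ-mod 2 ⟨
    toℕ (2 mod n)             ≡⟨ cong toℕ (mod-⊕ 1 1) ⟨
    toℕ ((1 mod n) ⊕ (1 mod n)) ≡⟨ cong (λ t → toℕ ((1 mod n) ⊕ t)) eq ⟨
    toℕ ((1 mod n) ⊖ (1 mod n)) ≡⟨ cong toℕ (⊕-inverseʳ (1 mod n)) ⟩
    toℕ (0 mod n)             ≡⟨ trans (toℕ-mod 0) (m<n⇒m%n≡m (ℕ.<-trans (ℕ.s≤s ℕ.z≤n) 2<n)) ⟩
    0                         ∎) λ ()
  where open ≡-Reasoning

module Scheme {n v k lam : ℕ} .{{_ : NonZero n}} (2≤n : 2 ≤ n) (2≤v : 2 ≤ v) (1≤k : 1 ≤ k)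
              (W : EntryMatrix n v) (bgw : IsBGW n v k lam W) where

  open Coloring W
  open Products W
  open Gram 2≤n W bgw using (label-refl; mat-Compatible; ∃-nonzero; ∃-zero; full-row)
  open Entries 2≤n W using (A₀-mat; A₁-mat; A₂-mat; A₃-mat)

  Occurs : Label n → Set
  Occurs ℓ = ∃[ x ] ∃[ y ] label x y ≡ ℓ

  label-encode : ∀ x y → label (encode x) (encode y) ≡ pointLabel x y
  label-encode x y = cong₂ pointLabel (decode-encode x) (decode-encode y)

  a₀ a₁ : Fin v
  a₀ = Fin.fromℕ< {0} (ℕ.<-trans (ℕ.s≤s ℕ.z≤n) 2≤v)
  a₁ = Fin.fromℕ< {1} 2≤v

  a₀≢a₁ : a₀ ≢ a₁
  a₀≢a₁ eq with trans (sym (Fin.toℕ-fromℕ< (ℕ.<-trans (ℕ.s≤s ℕ.z≤n) 2≤v))) (trans (cong toℕ eq) (Fin.toℕ-fromℕ< 2≤v))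
  ... | ()

  x₀ : Fin N
  x₀ = encode (inj₁ (0̄ , a₀))

  rot-occurs : ∀ i → Occurs (rot i)
  rot-occurs i = x₀ , T i x₀ , label-rot i x₀

  one-occurs : Occurs one
  one-occurs = x₀ , encode (inj₁ (0̄ , a₁)) , trans (label-encode (inj₁ (0̄ , a₀)) (inj₁ (0̄ , a₁))) (lemma (a₀ Fin.≟ a₁))
    where
    lemma : ∀ d → sameLabel d (0̄ ⊖ 0̄) ≡ one
    lemma (yes eq) = contradiction eq a₀≢a₁
    lemma (no _)   = refl

  two-occurs : ∀ i → Occurs (two i)
  two-occurs i with ∃-nonzero 1≤k a₀
  -- A nonzero entry in row `a₀` provides some label `two t`; translating the first point by i ⊖ t
  -- changes it to `two i`.
  ... | c , w , eq = T (i ⊖ t) x₀ , y , (begin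
      label (T (i ⊖ t) x₀) y     ≡⟨ label-Tˡ (i ⊖ t) x₀ y ⟩
      shift (i ⊖ t) (label x₀ y) ≡⟨ cong (shift (i ⊖ t))
                                      (trans (label-encode (inj₁ (0̄ , a₀)) (inj₂ (0̄ , c)))
                                             (cong (maybe′ (λ w → two (w ⊖ (0̄ ⊖ 0̄))) three) eq)) ⟩
      two (t ⊕ (i ⊖ t))          ≡⟨ cong two (trans (⊕-comm t (i ⊖ t)) ([i⊖j]⊕j≡i t i)) ⟩
      two i                      ∎)
    where
    open ≡-Reasoning
    t = w ⊖ (0̄ ⊖ 0̄)
    y = encode (inj₂ (0̄ , c))

  three-occurs : k < v → Occurs three
  three-occurs k<v with ∃-zero k<v a₀
  ... | c , eq = x₀ , encode (inj₂ (0̄ , c)) ,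
    trans (label-encode (inj₁ (0̄ , a₀)) (inj₂ (0̄ , c))) (cong (maybe′ (λ w → two (w ⊖ (0̄ ⊖ 0̄))) three) eq)

  pointLabel≢three : k ≡ v → ∀ x y → pointLabel x y ≢ three
  pointLabel≢three k≡v (inj₁ (p , a)) (inj₁ (q , b)) eq with a Fin.≟ b
  pointLabel≢three k≡v (inj₁ (p , a)) (inj₁ (q , b)) () | yes _
  pointLabel≢three k≡v (inj₁ (p , a)) (inj₁ (q , b)) () | no _
  pointLabel≢three k≡v (inj₁ (p , a)) (inj₂ (q , b)) eq with W a b in W≡
  ... | nothing = full-row k≡v a b W≡
  pointLabel≢three k≡v (inj₂ (p , a)) (inj₁ (q , b)) eq with W b a in W≡
  ... | nothing = full-row k≡v b a W≡
  pointLabel≢three k≡v (inj₂ (p , a)) (inj₂ (q , b)) eq with a Fin.≟ b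
  pointLabel≢three k≡v (inj₂ (p , a)) (inj₂ (q , b)) () | yes _
  pointLabel≢three k≡v (inj₂ (p , a)) (inj₂ (q , b)) () | no _

  -- `name` has to invert `index` only at labels that occur. With `three` absent for k = v, this
  -- lets both families share one proof.
  module Family {m : ℕ} (i₀ : Fin m) (A : Vector (Matrix N N) m) (name : Fin m → Label n) (index : Label n → Fin m)
    (A-mat : ∀ i → A i ≋ mat (name i)) (index-name : ∀ i → index (name i) ≡ i)
    (name-index : ∀ x y → name (index (label x y)) ≡ label x y)
    (occurs : ∀ i → Occurs (name i)) (name-i₀ : name i₀ ≡ rot 0̄) where

    name-index′ : ∀ {ℓ} → Occurs ℓ → name (index ℓ) ≡ ℓ
    name-index′ (x , y , refl) = name-index x y

    unique-name : ∀ x y i → label x y ≡ name i → i ≡ index (label x y)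
    unique-name x y i eq = trans (sym (index-name i)) (cong index (sym eq))

    reverse-name : ∀ i → name (index (reverse (name i))) ≡ reverse (name i)
    reverse-name i with occurs i
    ... | x , y , eq = name-index′ (y , x , trans (label-swap x y) (cong reverse eq))

    Aᵀ : ∀ i → A i ᵀ ≋ mat (reverse (name i))
    Aᵀ i x y = trans (A-mat i y x) (mat-swap (name i) x y)

    reverse-rot-0̄ : reverse (rot 0̄) ≡ rot 0̄
    reverse-rot-0̄ = cong rot ⊖0̄≡0̄

    isCommutativeAssociationScheme : IsCommutativeAssociationScheme i₀ A
    isCommutativeAssociationScheme = record
      { zero-one    = λ i x y → Sum.map (trans (A-mat i x y)) (trans (A-mat i x y)) (indicator-zero-one (label x y ≟ᴸ name i))
      ; nonzero     = nonzero
      ; identity    = λ x y → trans (A-mat i₀ x y) (trans (cong (λ ℓ → mat ℓ x y) name-i₀)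
          -- A label `rot 0̄` forces `y` to be `T 0̄ x`, and `label-refl` says the same of `x`.
          (indicator-⇔ (λ eq → trans (label-rot⇒ 0̄ x x (label-refl x)) (sym (label-rot⇒ 0̄ x y eq)))
                       (λ { refl → label-refl x }) (label x y ≟ᴸ rot 0̄) (x Fin.≟ y)))
      ; sums-to-J   = λ x y → trans (∑-cong m λ i → A-mat i x y)
          (∑-unique-1 (λ i → label x y ≟ᴸ name i) (index (label x y)) (sym (name-index x y)) (unique-name x y))
      ; transpose   = λ i i≢i₀ → index (reverse (name i)) ,
          -- `reverse` is an involution fixing `rot 0̄`, so only `i₀` itself can have its transpose
          -- at `i₀`.
          (λ eq → i≢i₀ (trans (sym (index-name i)) (trans (cong index (begin
            name i                   ≡⟨ reverse-involutive (name i) ⟨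
            reverse (reverse (name i)) ≡⟨ cong reverse (reverse-name i) ⟨
            reverse (name (index (reverse (name i)))) ≡⟨ cong (reverse ∘ name) eq ⟩
            reverse (name i₀)        ≡⟨ cong reverse name-i₀ ⟩
            reverse (rot 0̄)          ≡⟨ reverse-rot-0̄ ⟩
            rot 0̄                    ≡⟨ name-i₀ ⟨
            name i₀                  ∎)) (index-name i₀)))) ,
          λ x y → trans (Aᵀ i x y) (sym (trans (A-mat (index (reverse (name i))) x y)
                                              (cong (λ ℓ → mat ℓ x y) (reverse-name i))))
      ; product     = λ i j → (λ l → InSpan.coeff (span i j) (name l)) , product i j
      ; commutative = λ i j x y → trans (A-*ᴹ i j x y)
          (trans (Compatible.comm (mat-Compatible (name i) (name j)) x y) (sym (A-*ᴹ j i x y)))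
      }
      where
      open ≡-Reasoning
      nonzero : ∀ i → ¬ (A i ≋ 𝟘)
      nonzero i A≋𝟘 with occurs i
      ... | x , y , eq = contradiction
        (trans (sym (indicator-true (label x y ≟ᴸ name i) eq)) (trans (sym (A-mat i x y)) (A≋𝟘 x y))) λ ()
      A-*ᴹ : ∀ i j → A i *ᴹ A j ≋ mat (name i) *ᴹ mat (name j)
      A-*ᴹ i j = *ᴹ-cong {A = A i} {mat (name i)} {A j} {mat (name j)} (A-mat i) (A-mat j)
      span : ∀ i j → InSpan (mat (name i) *ᴹ mat (name j))
      span i j = Compatible.span (mat-Compatible (name i) (name j))
      product : ∀ i j → A i *ᴹ A j ≋ linearCombination (λ l → InSpan.coeff (span i j) (name l)) A
      product i j x y = begin
        (A i *ᴹ A j) x y                       ≡⟨ A-*ᴹ i j x y ⟩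
        (mat (name i) *ᴹ mat (name j)) x y     ≡⟨ InSpan.expand (span i j) x y ⟩
        c (label x y)                          ≡⟨ cong c (name-index x y) ⟨
        c (name (index (label x y)))
          ≡⟨ ∑-unique (λ l → label x y ≟ᴸ name l) (index (label x y)) (sym (name-index x y))
                      (unique-name x y) (λ l → c (name l)) ⟨
        ∑[ l < m ] (mat (name l) x y * c (name l))
          ≡⟨ ∑-cong m (λ l → trans (ℤ.*-comm (mat (name l) x y) (c (name l)))
                                   (cong (c (name l) *_) (sym (A-mat l x y)))) ⟩
        ∑[ l < m ] (c (name l) * A l x y) ∎
        where
        c = InSpan.coeff (span i j)

    -- The single matrix A₀ 1̄ already detects asymmetry, since its transpose is A₀ (⊖ 1̄).
    -- Conversely n = 2 makes `reverse` the identity on all labels.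
    symmetric⇔ : IsSymmetric A ⇔ n ≡ 2
    symmetric⇔ = mk⇔ to from
      where
      1̄ : Fin n
      1̄ = 1 mod n
      i₁ : Fin m
      i₁ = index (rot 1̄)
      name-i₁ : name i₁ ≡ rot 1̄
      name-i₁ = name-index′ (rot-occurs 1̄)
      A-i₁ : ∀ x y → A i₁ x y ≡ mat (rot 1̄) x y
      A-i₁ x y = trans (A-mat i₁ x y) (cong (λ ℓ → mat ℓ x y) name-i₁)
      to : IsSymmetric A → n ≡ 2
      to symmetric = ⊖1̄≡1̄⇒n≡2 2≤n (rot-injective (begin
        rot (⊖ 1̄)               ≡⟨ cong reverse (label-rot 1̄ x₀) ⟨
        reverse (label x₀ y)    ≡⟨ label-swap x₀ y ⟨
        label y x₀              ≡⟨ indicator≡1⇒ (label y x₀ ≟ᴸ rot 1̄) (begin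
          mat (rot 1̄) y x₀ ≡⟨ A-i₁ y x₀ ⟨
          A i₁ y x₀        ≡⟨ symmetric i₁ x₀ y ⟩
          A i₁ x₀ y        ≡⟨ A-i₁ x₀ y ⟩
          mat (rot 1̄) x₀ y ≡⟨ indicator-true (label x₀ y ≟ᴸ rot 1̄) (label-rot 1̄ x₀) ⟩
          1ℤ               ∎) ⟩
        rot 1̄                   ∎))
        where
        open ≡-Reasoning
        y = T 1̄ x₀
      reverse-trivial : n ≡ 2 → ∀ ℓ → reverse ℓ ≡ ℓ
      reverse-trivial n≡2 (rot i) = cong rot (n≡2⇒⊖i≡i n≡2 i)
      reverse-trivial n≡2 one     = refl
      reverse-trivial n≡2 (two i) = cong two (n≡2⇒⊖i≡i n≡2 i)
      reverse-trivial n≡2 three   = refl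
      from : n ≡ 2 → IsSymmetric A
      from n≡2 i x y = trans (Aᵀ i x y) (trans (cong (λ ℓ → mat ℓ x y) (reverse-trivial n≡2 (name i))) (sym (A-mat i x y)))

  -- The families for k = v and for k < v

  name : Fin (n ℕ.+ (1 ℕ.+ n)) → Label n
  name = rot ++ (one ∷ two)

  index : Label n → Fin (n ℕ.+ (1 ℕ.+ n))
  index (rot i) = i ↑ˡ (1 ℕ.+ n)
  index one     = n ↑ʳ zero
  index (two i) = n ↑ʳ suc i
  -- A dummy value: for k = v no pair of points has this label.
  index three   = n ↑ʳ zero

  withoutA₃-mat : ∀ i → withoutA₃ W i ≋ mat (name i)
  withoutA₃-mat i with splitAt n i
  ... | inj₁ j       = A₀-mat j
  ... | inj₂ zero    = A₁-mat
  ... | inj₂ (suc j) = A₂-mat j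

  index-name : ∀ i → index (name i) ≡ i
  index-name i with splitAt n i in eq
  ... | inj₁ j       = Fin.splitAt⁻¹-↑ˡ eq
  ... | inj₂ zero    = Fin.splitAt⁻¹-↑ʳ {n} eq
  ... | inj₂ (suc j) = Fin.splitAt⁻¹-↑ʳ {n} eq

  name-index : ∀ ℓ → ℓ ≢ three → name (index ℓ) ≡ ℓ
  name-index (rot i) _   = lookup-++ˡ rot (one ∷ two) i
  name-index one     _   = lookup-++ʳ (rot {n}) (one ∷ two) zero
  name-index (two i) _   = lookup-++ʳ (rot {n}) (one ∷ two) (suc i)
  name-index three   neq = contradiction refl neq

  name-occurs : ∀ i → Occurs (name i)
  name-occurs i with splitAt n i
  ... | inj₁ j       = rot-occurs j
  ... | inj₂ zero    = one-occurs
  ... | inj₂ (suc j) = two-occurs j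

  module WithoutA₃ (k≡v : k ≡ v) = Family identityIndex (withoutA₃ W) name index withoutA₃-mat index-name
    (λ x y → name-index (label x y) (pointLabel≢three k≡v (decode x) (decode y)))
    name-occurs (lookup-++ˡ rot (one ∷ two) 0̄)

  tail⁺ : Vector (Label n) (n ℕ.+ 1)
  tail⁺ = two ++ (three ∷ [])

  name⁺ : Fin (n ℕ.+ (1 ℕ.+ (n ℕ.+ 1))) → Label n
  name⁺ = rot ++ (one ∷ tail⁺)

  index⁺ : Label n → Fin (n ℕ.+ (1 ℕ.+ (n ℕ.+ 1)))
  index⁺ (rot i) = i ↑ˡ (1 ℕ.+ (n ℕ.+ 1))
  index⁺ one     = n ↑ʳ zero
  index⁺ (two i) = n ↑ʳ suc (i ↑ˡ 1)
  index⁺ three   = n ↑ʳ suc (n ↑ʳ zero)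

  withA₃-mat : ∀ i → withA₃ W i ≋ mat (name⁺ i)
  withA₃-mat i with splitAt n i
  ... | inj₁ j       = A₀-mat j
  ... | inj₂ zero    = A₁-mat
  ... | inj₂ (suc j) with splitAt n j
  ...   | inj₁ l    = A₂-mat l
  ...   | inj₂ zero = A₃-mat

  index⁺-name⁺ : ∀ i → index⁺ (name⁺ i) ≡ i
  index⁺-name⁺ i with splitAt n i in eq
  ... | inj₁ j       = Fin.splitAt⁻¹-↑ˡ eq
  ... | inj₂ zero    = Fin.splitAt⁻¹-↑ʳ {n} eq
  ... | inj₂ (suc j) with splitAt n j in eq′
  ...   | inj₁ l    = trans (cong (λ t → n ↑ʳ suc t) (Fin.splitAt⁻¹-↑ˡ eq′)) (Fin.splitAt⁻¹-↑ʳ {n} eq)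
  ...   | inj₂ zero = trans (cong (λ t → n ↑ʳ suc t) (Fin.splitAt⁻¹-↑ʳ {n} eq′)) (Fin.splitAt⁻¹-↑ʳ {n} eq)

  name⁺-index⁺ : ∀ ℓ → name⁺ (index⁺ ℓ) ≡ ℓ
  name⁺-index⁺ (rot i) = lookup-++ˡ rot (one ∷ tail⁺) i
  name⁺-index⁺ one     = lookup-++ʳ (rot {n}) (one ∷ tail⁺) zero
  name⁺-index⁺ (two i) = trans (lookup-++ʳ (rot {n}) (one ∷ tail⁺) (suc (i ↑ˡ 1))) (lookup-++ˡ two (three ∷ []) i)
  name⁺-index⁺ three   = trans (lookup-++ʳ (rot {n}) (one ∷ tail⁺) (suc (n ↑ʳ zero))) (lookup-++ʳ (two {n}) (three ∷ []) zero)

  name⁺-occurs : k < v → ∀ i → Occurs (name⁺ i)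
  name⁺-occurs k<v i with splitAt n i
  ... | inj₁ j       = rot-occurs j
  ... | inj₂ zero    = one-occurs
  ... | inj₂ (suc j) with splitAt n j
  ...   | inj₁ l    = two-occurs l
  ...   | inj₂ zero = three-occurs k<v

  module WithA₃ (k<v : k < v) = Family identityIndex (withA₃ W) name⁺ index⁺ withA₃-mat index⁺-name⁺
    (λ x y → name⁺-index⁺ (label x y)) (name⁺-occurs k<v) (lookup-++ˡ rot (one ∷ tail⁺) 0̄)

theorem8 : (n v k lam : ℕ) .{{_ : NonZero n}} → 2 ≤ n → 2 ≤ v → 1 ≤ k →
    (W : EntryMatrix n v) → IsBGW n v k lam W →
    (k ≡ v → IsCommutativeAssociationScheme identityIndex (withoutA₃ W))
    × (k < v → IsCommutativeAssociationScheme identityIndex (withA₃ W))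
    × (k ≡ v → IsSymmetric (withoutA₃ W) ⇔ n ≡ 2)
    × (k < v → IsSymmetric (withA₃ W) ⇔ n ≡ 2)
theorem8 n v k lam 2≤n 2≤v 1≤k W bgw =
  WithoutA₃.isCommutativeAssociationScheme , WithA₃.isCommutativeAssociationScheme ,
  WithoutA₃.symmetric⇔ , WithA₃.symmetric⇔
  where open Scheme 2≤n 2≤v 1≤k W bgw
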